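{- Let $G$ be a finite connected graph and let $r$ and $k$ be positive integers. Then $$\left(t^{(r)}_{2k}\right)^{1/(2k)}\ge (1-o(1))\sum_{j=0}^r\sqrt{\delta^{(j)}(G)\,\delta^{(r-j)}(G)},$$ where $o(1)\to0$ as $k\to\infty$ with $r$ (and the graph quantities $\delta^{(j)}$) held fixed.
   Context: $G^{(r)}$ is the graph on $V(G)$ with $u,v$ adjacent iff $d_G(u,v)\le r$, with adjacency matrix $A^{(r)}=\mathbb{1}((I+A)^r\ge1)$. $t^{(r)}_{2k}=\min_{x\in V(G)}[(A^{(r)})^{2k}]_{xx}$ is the minimum over vertices $x$ of the number of closed walks of length $2k$ in $G^{(r)}$ at $x$. For $i\ge0$, $\delta^{(i)}(G)=\min_{(x,y)\in E(G)}|\{v\in V(G): d_G(x,v)=i,\ d_G(y,v)\ge i\}|$. -}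

module Defs where

open import Data.Bool using (Bool; true; false; _∧_; _∨_; not; if_then_else_)
open import Data.Nat as ℕ using (ℕ; zero; suc; _∸_; _⊓_)
open import Data.Fin using (Fin; toℕ; _≟_)
open import Data.List using (List; []; _∷_; allFin; concatMap; foldr; map)
open import Data.Nat.ListAction using (sum)
open import Data.Bool.ListAction using (any)
open import Data.Integer using (+_)
open import Data.Rational using (ℚ; _/_; 1ℚ; 0ℚ) renaming (_*_ to _*ℚ_; _+_ to _+ℚ_)
open import Data.Product using (∃-syntax)
open import Relation.Binary.PropositionalEquality using (_≡_)
open import Relation.Nullary.Decidable using (⌊_⌋)

record Graph (n : ℕ) : Set where
  field
    adj    : Fin n → Fin n → Bool
    sym    : ∀ u v → adj u v ≡ adj v u
    irrefl : ∀ u → adj u u ≡ false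
open Graph public

sumFin : ∀ {n} → (Fin n → ℕ) → ℕ
sumFin {n} f = sum (map f (allFin n))

-- Minimum of a list of naturals (default 0 for the empty list; never used
-- on empty lists in the theorem since the graphs there have ≥ 2 vertices
-- and are connected, hence have edges).
listMin : List ℕ → ℕ
listMin []       = 0
listMin (x ∷ xs) = foldr _⊓_ x xs

within : ∀ {n} → Graph n → ℕ → Fin n → Fin n → Bool
within G zero    u v = ⌊ u ≟ v ⌋
within G (suc i) u v =
  within G i u v ∨ any (λ w → within G i u w ∧ adj G w v) (allFin _)

Connected : ∀ {n} → Graph n → Set
Connected G = ∀ u v → ∃[ i ] (within G i u v ≡ true)

distEq : ∀ {n} → Graph n → ℕ → Fin n → Fin n → Bool
distEq G zero    u v = within G zero u v
distEq G (suc i) u v = within G (suc i) u v ∧ not (within G i u v)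

distGe : ∀ {n} → Graph n → ℕ → Fin n → Fin n → Bool
distGe G zero    u v = true
distGe G (suc i) u v = not (within G i u v)

deltaAt : ∀ {n} → Graph n → ℕ → Fin n → Fin n → ℕ
deltaAt G i x y =
  sumFin (λ v → if distEq G i x v ∧ distGe G i y v then 1 else 0)

δ : ∀ {n} → Graph n → ℕ → ℕ
δ {n} G i = listMin (concatMap (λ x → concatMap
              (λ y → if adj G x y then deltaAt G i x y ∷ [] else [])
              (allFin n)) (allFin n))

-- Adjacency matrix of G^{(r)}: A^{(r)} = 1((I + A)^r ≥ 1), i.e. d_G(u,v) ≤ r
-- (diagonal entries are 1).
Apow : ∀ {n} → Graph n → ℕ → Fin n → Fin n → ℕ
Apow G r u v = if within G r u v then 1 else 0

walks : ∀ {n} → Graph n → ℕ → ℕ → Fin n → Fin n → ℕ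
walks G r zero    x y = if ⌊ x ≟ y ⌋ then 1 else 0
walks G r (suc m) x y = sumFin (λ w → Apow G r x w ℕ.* walks G r m w y)

t : ∀ {n} → Graph n → ℕ → ℕ → ℕ
t {n} G r k = listMin (map (λ x → walks G r (2 ℕ.* k) x x) (allFin n))

ℕtoℚ : ℕ → ℚ
ℕtoℚ m = (+ m) / 1

_^ℚ_ : ℚ → ℕ → ℚ
q ^ℚ zero  = 1ℚ
q ^ℚ suc m = q *ℚ (q ^ℚ m)

sumFinℚ : ∀ {n} → (Fin n → ℚ) → ℚ
sumFinℚ {n} f = foldr _+ℚ_ 0ℚ (map f (allFin n))

{-# OPTIONS --safe #-}
-- A walk in G^(r) is generated by a stack: keep a ray issuing from the current vertex and, for a parameter j ≤ r,
-- retreat to the j-th vertex of the ray and move away from it to a vertex at distance r - j. Such a step is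
-- possible in at least δ^(r-j) ways and raises the level by r - 2j, and different j lead to different vertices. As
-- long as the level stays in a window of size N the walk stays at bounded distance from its start, so it can be
-- closed at bounded cost. Closed walks are therefore bounded below by weighted lattice paths of step r - 2j and weight
-- δ^(r-j) in the window. Reversing the paths replaces δ^(r-j) by δ^(j) without changing the total, and by the
-- Cauchy–Schwarz inequality the total is at least the one for the symmetric weights √(δ^(j) δ^(r-j)). For these a
-- wide tent function is an approximate eigenvector with eigenvalue close to the sum of the weights.

module Submission where

open import Defs
open import Data.Nat using (ℕ; suc; _≤_; _∸_; _*_)
open import Data.Fin using (Fin; toℕ)
open import Data.Rational using (ℚ; 0ℚ; 1ℚ; _-_; _<_) renaming (_≤_ to _≤ℚ_; _*_ to _*ℚ_)
open import Data.Product using (∃-syntax; _×_)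
open import Relation.Binary.PropositionalEquality using (_≡_)

open import Data.Bool using (Bool; true; false; if_then_else_; _∧_)
open import Data.Bool.Properties using (T-≡; T-∧; T-∨; T-not-≡)
open import Data.Empty using (⊥; ⊥-elim)
open import Data.Fin using (zero; suc; fromℕ<) renaming (_≟_ to _≟ᶠ_)
open import Data.Fin.Properties using (toℕ<n; toℕ-fromℕ<)
open import Data.List using (List; []; _∷_; map; foldr; upTo; allFin; applyUpTo; applyDownFrom; reverse; tabulate)
open import Data.List.Membership.Propositional using (_∈_)
open import Data.List.Membership.Propositional.Properties using (∈-upTo⁺; ∈-upTo⁻; ∈-allFin; ∈-map⁻; ∈-concatMap⁺)
open import Data.List.Properties using (map-upTo; reverse-upTo; map-tabulate; map-∘)
open import Data.List.Relation.Binary.Permutation.Propositional.Properties using (↭-reverse) renaming (map⁺ to ↭-map⁺)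
import Data.List.Relation.Unary.All as All
open import Data.List.Relation.Unary.AllPairs using ([]; _∷_)
open import Data.List.Relation.Unary.Any as Any using (here; there)
open import Data.List.Relation.Unary.Any.Properties using (any⁺; any⁻)
open import Data.List.Relation.Unary.Unique.Propositional using (Unique)
open import Data.List.Relation.Unary.Unique.Propositional.Properties using (upTo⁺)
open import Data.Nat using (zero; _+_; _^_; _⊔_; _⊓_; z≤n; s≤s; _≤?_; _<?_; _≟_; NonZero; >-nonZero) renaming (_<_ to _<ℕ_)
open import Data.Nat.ListAction using (sum)
open import Data.Nat.ListAction.Properties using (sum-↭)
open import Data.Nat.Properties
open import Data.Nat.Tactic.RingSolver using (solve-∀)
open import Data.Product using (_,_; proj₁; proj₂; ∃)
open import Data.Sum using (_⊎_; inj₁; inj₂)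
open import Data.Unit using (tt)
open import Function using (_∘_; id; Equivalence)
open import Relation.Binary.PropositionalEquality using (refl; trans; cong; cong₂; subst; subst₂; _≢_; module ≡-Reasoning) renaming (sym to ≡-sym)
open import Relation.Binary using (tri<; tri≈; tri>)
open import Relation.Nullary using (yes; no; ¬_; contradiction)
open import Relation.Nullary.Decidable using (⌊_⌋; decidable-stable)

import Data.Integer as ℤ
import Data.Integer.Properties as ℤ
import Data.Rational as ℚ
import Data.Rational.Properties as ℚ
import Data.Rational.Unnormalised as ℚᵘ
import Data.Rational.Unnormalised.Properties as ℚᵘ
open import Algebra.Bundles using (CommutativeMonoid)
open import Algebra.Properties.CommutativeSemigroup (CommutativeMonoid.commutativeSemigroup ℚ.*-1-commutativeMonoid)
  using () renaming (interchange to *ℚ-interchange)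

-- Finite sums

private variable
  I J : Set

Σ : List I → (I → ℕ) → ℕ
Σ xs f = sum (map f xs)

Σ-mono : ∀ (xs : List I) {f g : I → ℕ} → (∀ {x} → x ∈ xs → f x ≤ g x) → Σ xs f ≤ Σ xs g
Σ-mono []       h = z≤n
Σ-mono (x ∷ xs) h = +-mono-≤ (h (here refl)) (Σ-mono xs (h ∘ there))

Σ-cong : ∀ (xs : List I) {f g : I → ℕ} → (∀ {x} → x ∈ xs → f x ≡ g x) → Σ xs f ≡ Σ xs g
Σ-cong []       h = refl
Σ-cong (x ∷ xs) h = cong₂ _+_ (h (here refl)) (Σ-cong xs (h ∘ there))

Σ-zero : ∀ (xs : List I) {f : I → ℕ} → (∀ {x} → x ∈ xs → f x ≡ 0) → Σ xs f ≡ 0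
Σ-zero []       h = refl
Σ-zero (x ∷ xs) h = cong₂ _+_ (h (here refl)) (Σ-zero xs (h ∘ there))

Σ-+ : ∀ (xs : List I) (f g : I → ℕ) → Σ xs (λ x → f x + g x) ≡ Σ xs f + Σ xs g
Σ-+ []       f g = refl
Σ-+ (x ∷ xs) f g rewrite Σ-+ xs f g = interchange (f x) (g x) (Σ xs f) (Σ xs g)
  where
  interchange : ∀ a b c d → a + b + (c + d) ≡ a + c + (b + d)
  interchange = solve-∀

Σ-*ˡ : ∀ (xs : List I) c (f : I → ℕ) → Σ xs (λ x → c * f x) ≡ c * Σ xs f
Σ-*ˡ []       c f = ≡-sym (*-zeroʳ c)
Σ-*ˡ (x ∷ xs) c f rewrite Σ-*ˡ xs c f = ≡-sym (*-distribˡ-+ c (f x) (Σ xs f))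

Σ-*ʳ : ∀ (xs : List I) c (f : I → ℕ) → Σ xs (λ x → f x * c) ≡ Σ xs f * c
Σ-*ʳ []       c f = refl
Σ-*ʳ (x ∷ xs) c f rewrite Σ-*ʳ xs c f = ≡-sym (*-distribʳ-+ c (f x) (Σ xs f))

Σ-swap : ∀ (xs : List I) (ys : List J) (f : I → J → ℕ) →
         Σ xs (λ x → Σ ys (f x)) ≡ Σ ys (λ y → Σ xs (λ x → f x y))
Σ-swap []       ys f = ≡-sym (Σ-zero ys (λ _ → refl))
Σ-swap (x ∷ xs) ys f rewrite Σ-swap xs ys f = ≡-sym (Σ-+ ys (f x) (λ y → Σ xs (λ x → f x y)))

Σ-member : ∀ {xs : List I} {x} (f : I → ℕ) → x ∈ xs → f x ≤ Σ xs f
Σ-member f (here refl) = m≤m+n _ _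
Σ-member f (there x∈)  = ≤-trans (Σ-member f x∈) (m≤n+m _ _)

Σ-const : ∀ n c → Σ (upTo n) (λ _ → c) ≡ n * c
Σ-const n c = trans (cong sum (map-upTo (λ _ → c) n)) (go n)
  where
  go : ∀ n → sum (applyUpTo (λ _ → c) n) ≡ n * c
  go zero    = refl
  go (suc n) = cong (c +_) (go n)

-- Turns injectivity into a bound on a sum. It is applied once because the parameter `j` of a step
-- determines the new level, and once because the chosen vertex determines `j`.
Σ-single : ∀ {xs : List I} {X} {f : I → ℕ} → Unique xs → (∀ {x} → x ∈ xs → f x ≤ X) →
           (∀ {x y} → x ∈ xs → y ∈ xs → f x ≢ 0 → f y ≢ 0 → x ≡ y) → Σ xs f ≤ X
Σ-single []       b u = z≤n
Σ-single {xs = x ∷ xs} {X} {f} (x∉ ∷ uxs) b u with f x ≟ 0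
... | yes fx≡0 rewrite fx≡0 = Σ-single uxs (b ∘ there) (λ p q → u (there p) (there q))
... | no  fx≢0 = ≤-trans (≤-reflexive (trans (cong (f x +_) rest) (+-identityʳ _))) (b (here refl))
  where
  rest : Σ xs f ≡ 0
  rest = Σ-zero xs λ {y} y∈ → decidable-stable (f y ≟ 0) λ fy≢0 →
           All.lookup x∉ y∈ (u (here refl) (there y∈) fx≢0 fy≢0)

Σ-reverse : ∀ r (f : ℕ → ℕ) → Σ (upTo (suc r)) (λ j → f (r ∸ j)) ≡ Σ (upTo (suc r)) f
Σ-reverse r f = begin
  sum (map (f ∘ (r ∸_)) (upTo (suc r)))     ≡⟨ cong sum (map-∘ (upTo (suc r))) ⟩
  sum (map f (map (r ∸_) (upTo (suc r))))   ≡⟨ cong (sum ∘ map f) (trans (map-upTo (r ∸_) (suc r)) (down r)) ⟩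
  sum (map f (applyDownFrom id (suc r)))    ≡⟨ cong (sum ∘ map f) (reverse-upTo (suc r)) ⟨
  sum (map f (reverse (upTo (suc r))))      ≡⟨ sum-↭ (↭-map⁺ f (↭-reverse (upTo (suc r)))) ⟩
  sum (map f (upTo (suc r)))                ∎
  where
  open ≡-Reasoning
  down : ∀ r → applyUpTo (r ∸_) (suc r) ≡ applyDownFrom id (suc r)
  down zero    = refl
  down (suc r) = cong (suc r ∷_) (down r)

-- The Cauchy–Schwarz inequality

m²≤n²⇒m≤n : ∀ {m n} → m * m ≤ n * n → m ≤ n
m²≤n²⇒m≤n {m} {n} h with m ≤? n
... | yes p = p
... | no  p = contradiction h (<⇒≱ (*-mono-< (≰⇒> p) (≰⇒> p)))

-- The inequality of arithmetic and geometric means, with `z` in place of the root: for y = x + e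
-- the difference of (x + y)² and 4xy is e².
2√xy≤x+y : ∀ {x y z} → z * z ≤ x * y → 2 * z ≤ x + y
2√xy≤x+y {x} {y} {z} h = m²≤n²⇒m≤n (begin
  (2 * z) * (2 * z)      ≡⟨ double z ⟩
  4 * (z * z)            ≤⟨ *-monoʳ-≤ 4 h ⟩
  4 * (x * y)            ≤⟨ 4xy≤ x y (≤-total x y) ⟩
  (x + y) * (x + y)      ∎)
  where
  open ≤-Reasoning
  double : ∀ z → (2 * z) * (2 * z) ≡ 4 * (z * z)
  double = solve-∀
  square : ∀ x e → 4 * (x * (x + e)) + e * e ≡ (x + (x + e)) * (x + (x + e))
  square = solve-∀
  4xy≤′ : ∀ x y → x ≤ y → 4 * (x * y) ≤ (x + y) * (x + y)
  4xy≤′ x y x≤y with m≤n⇒∃[o]m+o≡n x≤y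
  ... | e , refl = ≤-trans (m≤m+n _ _) (≤-reflexive (square x e))
  4xy≤ : ∀ x y → x ≤ y ⊎ y ≤ x → 4 * (x * y) ≤ (x + y) * (x + y)
  4xy≤ x y (inj₁ p) = 4xy≤′ x y p
  4xy≤ x y (inj₂ p) rewrite *-comm x y | +-comm x y = 4xy≤′ y x p

*-interchange : ∀ a b c d → (a * b) * (c * d) ≡ (a * c) * (b * d)
*-interchange = solve-∀

-- `c x` stands in for the root of `a x * b x`, so everything stays in ℕ. When a term is added, the
-- cross term is settled by the means inequality for `a x * Bs` and `b x * As`, whose product bounds
-- the square of `c x * C`.
Σ-cauchy : ∀ (xs : List I) (a b c : I → ℕ) → (∀ {x} → x ∈ xs → c x * c x ≤ a x * b x) →
           Σ xs c * Σ xs c ≤ Σ xs a * Σ xs b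
Σ-cauchy []       a b c h = z≤n
Σ-cauchy (x ∷ xs) a b c h = begin
  (c x + C) * (c x + C)                           ≡⟨ expand (c x) C ⟩
  c x * c x + 2 * (c x * C) + C * C               ≤⟨ +-mono-≤ (+-mono-≤ (h (here refl)) cross) IH ⟩
  a x * b x + (a x * Bs + b x * As) + As * Bs     ≡⟨ collect (a x) (b x) As Bs ⟩
  (a x + As) * (b x + Bs)                         ∎
  where
  open ≤-Reasoning
  As = Σ xs a
  Bs = Σ xs b
  C  = Σ xs c
  IH : C * C ≤ As * Bs
  IH = Σ-cauchy xs a b c (h ∘ there)
  expand : ∀ c C → (c + C) * (c + C) ≡ c * c + 2 * (c * C) + C * C
  expand = solve-∀
  collect : ∀ a b A B → a * b + (a * B + b * A) + A * B ≡ (a + A) * (b + B)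
  collect = solve-∀
  regroup : ∀ a b A B → (a * b) * (A * B) ≡ (a * B) * (b * A)
  regroup = solve-∀
  cross : 2 * (c x * C) ≤ a x * Bs + b x * As
  cross = 2√xy≤x+y {a x * Bs} {b x * As} {c x * C} (begin
    (c x * C) * (c x * C)       ≡⟨ *-interchange (c x) C (c x) C ⟩
    (c x * c x) * (C * C)       ≤⟨ *-mono-≤ (h (here refl)) IH ⟩
    (a x * b x) * (As * Bs)     ≡⟨ regroup (a x) (b x) As Bs ⟩
    (a x * Bs) * (b x * As)     ∎)

-- Nonnegative matrices on the levels 0, …, N - 1

-- Matrices and vectors are functions on all of ℕ; the window enters only through the range of
-- summation.
apply : ℕ → (ℕ → ℕ → ℕ) → (ℕ → ℕ) → ℕ → ℕ
apply N M u a = Σ (upTo N) (λ b → M a b * u b)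

pow : ℕ → (ℕ → ℕ → ℕ) → ℕ → (ℕ → ℕ) → ℕ → ℕ
pow N M zero    u = u
pow N M (suc m) u = apply N M (pow N M m u)

𝟙 : ℕ → ℕ
𝟙 _ = 1

pow-apply : ∀ N M m u → pow N M m (apply N M u) ≡ pow N M (suc m) u
pow-apply N M zero    u = refl
pow-apply N M (suc m) u = cong (apply N M) (pow-apply N M m u)

pow-cong : ∀ N {M M′} → (∀ a b → M a b ≡ M′ a b) → ∀ m u a → pow N M m u a ≡ pow N M′ m u a
pow-cong N h zero    u a = refl
pow-cong N h (suc m) u a = Σ-cong (upTo N) λ {b} _ → cong₂ _*_ (h a b) (pow-cong N h m u b)

apply-adjoint : ∀ N M u v →
  Σ (upTo N) (λ a → u a * apply N M v a) ≡ Σ (upTo N) (λ a → apply N (λ a b → M b a) u a * v a)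
apply-adjoint N M u v = begin
  Σ (upTo N) (λ a → u a * Σ (upTo N) (λ b → M a b * v b))
    ≡⟨ Σ-cong (upTo N) (λ {a} _ → ≡-sym (Σ-*ˡ (upTo N) (u a) (λ b → M a b * v b))) ⟩
  Σ (upTo N) (λ a → Σ (upTo N) (λ b → u a * (M a b * v b)))
    ≡⟨ Σ-swap (upTo N) (upTo N) (λ a b → u a * (M a b * v b)) ⟩
  Σ (upTo N) (λ b → Σ (upTo N) (λ a → u a * (M a b * v b)))
    ≡⟨ Σ-cong (upTo N) (λ {b} _ → Σ-cong (upTo N) (λ {a} _ → shuffle (u a) (M a b) (v b))) ⟩
  Σ (upTo N) (λ b → Σ (upTo N) (λ a → M a b * u a * v b))
    ≡⟨ Σ-cong (upTo N) (λ {b} _ → Σ-*ʳ (upTo N) (v b) (λ a → M a b * u a)) ⟩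
  Σ (upTo N) (λ b → Σ (upTo N) (λ a → M a b * u a) * v b) ∎
  where
  open ≡-Reasoning
  shuffle : ∀ x y z → x * (y * z) ≡ y * x * z
  shuffle = solve-∀

pow-adjoint : ∀ N M m u v →
  Σ (upTo N) (λ a → u a * pow N M m v a) ≡ Σ (upTo N) (λ a → pow N (λ a b → M b a) m u a * v a)
pow-adjoint N M zero    u v = refl
pow-adjoint N M (suc m) u v = begin
  Σ (upTo N) (λ a → u a * pow N M (suc m) v a)
    ≡⟨ apply-adjoint N M u (pow N M m v) ⟩
  Σ (upTo N) (λ a → apply N Mᵀ u a * pow N M m v a)
    ≡⟨ pow-adjoint N M m (apply N Mᵀ u) v ⟩
  Σ (upTo N) (λ a → pow N Mᵀ m (apply N Mᵀ u) a * v a)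
    ≡⟨ cong (λ f → Σ (upTo N) (λ a → f a * v a)) (pow-apply N Mᵀ m u) ⟩
  Σ (upTo N) (λ a → pow N Mᵀ (suc m) u a * v a) ∎
  where
  open ≡-Reasoning
  Mᵀ : ℕ → ℕ → ℕ
  Mᵀ a b = M b a

-- Adjointness with `𝟙` on both sides. The total counts weighted paths of `m` steps in the window,
-- and transposing traverses them backwards.
pow-transpose : ∀ N M m → Σ (upTo N) (pow N M m 𝟙) ≡ Σ (upTo N) (pow N (λ a b → M b a) m 𝟙)
pow-transpose N M m = begin
  Σ (upTo N) (pow N M m 𝟙)                            ≡⟨ Σ-cong (upTo N) (λ _ → ≡-sym (*-identityˡ _)) ⟩
  Σ (upTo N) (λ a → 1 * pow N M m 𝟙 a)                ≡⟨ pow-adjoint N M m 𝟙 𝟙 ⟩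
  Σ (upTo N) (λ a → pow N (λ a b → M b a) m 𝟙 a * 1)  ≡⟨ Σ-cong (upTo N) (λ _ → *-identityʳ _) ⟩
  Σ (upTo N) (pow N (λ a b → M b a) m 𝟙)              ∎
  where open ≡-Reasoning

-- Path weights are products of entries, so the hypothesis passes from entries to paths; the
-- induction applies Cauchy-Schwarz to the sum over the first step.
pow-cauchy : ∀ N {A B C : ℕ → ℕ → ℕ} → (∀ a b → C a b * C a b ≤ A a b * B a b) →
             ∀ m a → pow N C m 𝟙 a * pow N C m 𝟙 a ≤ pow N A m 𝟙 a * pow N B m 𝟙 a
pow-cauchy N h zero    a = ≤-refl
pow-cauchy N {A} {B} {C} h (suc m) a = Σ-cauchy (upTo N) _ _ _ λ {b} _ → begin
  (C a b * c b) * (C a b * c b)   ≡⟨ *-interchange (C a b) (c b) (C a b) (c b) ⟩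
  (C a b * C a b) * (c b * c b)   ≤⟨ *-mono-≤ (h a b) (pow-cauchy N h m b) ⟩
  (A a b * B a b) * (x b * y b)   ≡⟨ *-interchange (A a b) (B a b) (x b) (y b) ⟩
  (A a b * x b) * (B a b * y b)   ∎
  where
  open ≤-Reasoning
  x = pow N A m 𝟙
  y = pow N B m 𝟙
  c = pow N C m 𝟙

pow-scale : ∀ N M D m a → pow N (λ a b → D * M a b) m 𝟙 a ≡ D ^ m * pow N M m 𝟙 a
pow-scale N M D zero    a = refl
pow-scale N M D (suc m) a = trans
  (Σ-cong (upTo N) λ {b} _ → trans (cong (D * M a b *_) (pow-scale N M D m b)) (*-interchange D (M a b) (D ^ m) _))
  (Σ-*ˡ (upTo N) (D ^ suc m) (λ b → M a b * pow N M m 𝟙 b))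

-- Weighted Toeplitz matrices

-- A step with parameter `j` leads from level a to level a + r - 2j. The equation is written without
-- subtraction, so truncation at 0 cannot create spurious steps.
entry : ℕ → (ℕ → ℕ) → ℕ → ℕ → ℕ → ℕ
entry r w a b j = if ⌊ b + 2 * j ≟ a + r ⌋ then w j else 0

toeplitz : ℕ → (ℕ → ℕ) → ℕ → ℕ → ℕ
toeplitz r w a b = Σ (upTo (suc r)) (entry r w a b)

entry-≡ : ∀ {r w a b j} → b + 2 * j ≡ a + r → entry r w a b j ≡ w j
entry-≡ {r} {w} {a} {b} {j} p with b + 2 * j ≟ a + r
... | yes _ = refl
... | no ¬p = contradiction p ¬p

entry-≢ : ∀ {r w a b j} → b + 2 * j ≢ a + r → entry r w a b j ≡ 0
entry-≢ {r} {w} {a} {b} {j} ¬p with b + 2 * j ≟ a + r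
... | yes p = contradiction p ¬p
... | no _  = refl

-- For j ≤ r, b + 2j = a + r and a + 2(r - j) = b + r are the same equation.
entry-reverse : ∀ {r} w a b {j} → j ≤ r → entry r w b a (r ∸ j) ≡ entry r (λ j → w (r ∸ j)) a b j
entry-reverse {r} w a b {j} j≤r with b + 2 * j ≟ a + r | m≤n⇒∃[o]m+o≡n j≤r
... | yes p | i , refl = entry-≡ {w = w} {a = b} {b = a} {j = j + i ∸ j} (trans (cong (λ k → a + 2 * k) (m+n∸m≡n j i))
       (+-cancelʳ-≡ j _ _ (trans (lhs a i j) (trans (cong (_+ i) (≡-sym p)) (rhs b i j)))))
  where
  lhs : ∀ a i j → a + 2 * i + j ≡ a + (j + i) + i
  lhs = solve-∀
  rhs : ∀ b i j → b + 2 * j + i ≡ b + (j + i) + j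
  rhs = solve-∀
... | no ¬p | i , refl = entry-≢ {w = w} {a = b} {b = a} {j = j + i ∸ j} (λ q → ¬p (+-cancelʳ-≡ i _ _ (trans (lhs b i j)
       (trans (cong (_+ j) (≡-sym (trans (cong (λ k → a + 2 * k) (≡-sym (m+n∸m≡n j i))) q))) (rhs a i j)))))
  where
  lhs : ∀ b i j → b + 2 * j + i ≡ b + (j + i) + j
  lhs = solve-∀
  rhs : ∀ a i j → a + 2 * i + j ≡ a + (j + i) + i
  rhs = solve-∀

toeplitz-transpose : ∀ r w a b → toeplitz r w b a ≡ toeplitz r (λ j → w (r ∸ j)) a b
toeplitz-transpose r w a b = trans (≡-sym (Σ-reverse r (entry r w b a)))
  (Σ-cong (upTo (suc r)) λ j∈ → entry-reverse w a b (≤-pred (∈-upTo⁻ j∈)))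

toeplitz-scale : ∀ r D w a b → toeplitz r (λ j → D * w j) a b ≡ D * toeplitz r w a b
toeplitz-scale r D w a b = trans (Σ-cong (upTo (suc r)) λ {j} _ → scale j) (Σ-*ˡ (upTo (suc r)) D (entry r w a b))
  where
  scale : ∀ j → entry r (λ j → D * w j) a b j ≡ D * entry r w a b j
  scale j with b + 2 * j ≟ a + r
  ... | yes _ = refl
  ... | no  _ = ≡-sym (*-zeroʳ D)

toeplitz-cauchy : ∀ r (x y z : ℕ → ℕ) → (∀ j → j ≤ r → z j * z j ≤ x j * y j) →
  ∀ a b → toeplitz r z a b * toeplitz r z a b ≤ toeplitz r x a b * toeplitz r y a b
toeplitz-cauchy r x y z h a b = Σ-cauchy (upTo (suc r)) (entry r x a b) (entry r y a b) (entry r z a b) λ j∈ → go (≤-pred (∈-upTo⁻ j∈))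
  where
  go : ∀ {j} → j ≤ r → entry r z a b j * entry r z a b j ≤ entry r x a b j * entry r y a b j
  go {j} j≤r with b + 2 * j ≟ a + r
  ... | yes _ = h j j≤r
  ... | no  _ = z≤n

-- Sorts the steps by `j` rather than by target level, which is the order used both for the tent and
-- for the walks.
apply-toeplitz : ∀ N r w u a → apply N (toeplitz r w) u a ≡ Σ (upTo (suc r)) (λ j → Σ (upTo N) (λ b → entry r w a b j * u b))
apply-toeplitz N r w u a = trans
  (Σ-cong (upTo N) λ {b} _ → ≡-sym (Σ-*ʳ (upTo (suc r)) (u b) (entry r w a b)))
  (Σ-swap (upTo N) (upTo (suc r)) (λ b j → entry r w a b j * u b))

-- Transposing the matrix reverses the weights without changing the total, so the two totals in the
-- Cauchy–Schwarz inequality for w and its reversal agree.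
Σ-pow-geometric-mean : ∀ N r (w Q : ℕ → ℕ) D → (∀ j → j ≤ r → Q j * Q j ≤ (D * w j) * (D * w (r ∸ j))) →
  ∀ m → Σ (upTo N) (pow N (toeplitz r Q) m 𝟙) ≤ D ^ m * Σ (upTo N) (pow N (toeplitz r w) m 𝟙)
Σ-pow-geometric-mean N r w Q D h m = subst (S Q ≤_) Sw′≡ (m²≤n²⇒m≤n (begin
  S Q * S Q      ≤⟨ Σ-cauchy (upTo N) _ _ _ (λ {a} _ → pow-cauchy N (toeplitz-cauchy r w′ w″ Q h) m a) ⟩
  S w′ * S w″    ≡⟨ cong (S w′ *_) Sw″≡ ⟨
  S w′ * S w′    ∎))
  where
  open ≤-Reasoning
  w′ w″ : ℕ → ℕ
  w′ j = D * w j
  w″ j = D * w (r ∸ j)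
  S : (ℕ → ℕ) → ℕ
  S v = Σ (upTo N) (pow N (toeplitz r v) m 𝟙)
  Sw′≡ : S w′ ≡ D ^ m * Σ (upTo N) (pow N (toeplitz r w) m 𝟙)
  Sw′≡ = trans (Σ-cong (upTo N) λ {a} _ → trans (pow-cong N (toeplitz-scale r D w) m 𝟙 a) (pow-scale N (toeplitz r w) D m a))
               (Σ-*ˡ (upTo N) (D ^ m) (pow N (toeplitz r w) m 𝟙))
  Sw″≡ : S w′ ≡ S w″
  Sw″≡ = trans (pow-transpose N (toeplitz r w′) m)
               (Σ-cong (upTo N) λ {a} _ → pow-cong N (λ a b → toeplitz-transpose r w′ a b) m 𝟙 a)

-- The tent function as an approximate eigenvector

module Tent (r E : ℕ) where

  -- The tent `u` is positive only strictly between `r` and `top`, so a shift by at most `r` from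
  -- there neither drops below 0 nor leaves the window of size `levels`. `H` allows for the foot,
  -- where `u` is at most `suc E * r`, and two further shifts by `r`. The summand 2 makes
  -- `u (suc r)` at least 1 even for `r` zero.
  H top levels : ℕ
  H      = (3 + E) * r
  top    = 2 + 2 * H
  levels = top + r

  u : ℕ → ℕ
  u x = (x ∸ r) ⊓ (top ∸ x)

  u≤top : ∀ x → u x ≤ top
  u≤top x = ≤-trans (m⊓n≤n (x ∸ r) (top ∸ x)) (m∸n≤m top x)

  r≤H : r ≤ H
  r≤H = m≤m+n r _

  r+H≤2H : r + H ≤ 2 * H
  r+H≤2H = ≤-trans (+-monoˡ-≤ H r≤H) (≤-reflexive (cong (H +_) (≡-sym (+-identityʳ H))))

  u-suc-r : 1 ≤ u (suc r)
  u-suc-r = ⊓-glb (≤-reflexive (≡-sym (m+n∸n≡m 1 r))) (m+n≤o⇒m≤o∸n 1 (s≤s (s≤s (≤-trans (m≤m+n r H) r+H≤2H))))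

  private
    n≤r+n∸r : ∀ n → n ≤ (n ∸ r) + r
    n≤r+n∸r n = ≤-trans (m≤n+m∸n n r) (≤-reflexive (+-comm r (n ∸ r)))

  -- Midpoint convexity of the positive part of x - r; `upper` is the mirror image for the
  -- descending side.
  lower : ∀ {a b b′} → b + b′ ≡ 2 * a → 2 * (a ∸ r) ≤ (b ∸ r) + (b′ ∸ r)
  lower {a} {b} {b′} mid = begin
    2 * (a ∸ r)                  ≡⟨ *-distribˡ-∸ 2 a r ⟩
    2 * a ∸ 2 * r                ≡⟨ cong (_∸ 2 * r) mid ⟨
    b + b′ ∸ 2 * r               ≤⟨ m≤n+o⇒m∸n≤o (b + b′) (2 * r) (≤-trans (+-mono-≤ (n≤r+n∸r b) (n≤r+n∸r b′)) (≤-reflexive (shuffle (b ∸ r) (b′ ∸ r) r))) ⟩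
    (b ∸ r) + (b′ ∸ r)           ∎
    where
    open ≤-Reasoning
    shuffle : ∀ x y r → x + r + (y + r) ≡ 2 * r + (x + y)
    shuffle = solve-∀

  upper : ∀ {a b b′} → b + b′ ≡ 2 * a → 2 * (top ∸ a) ≤ (top ∸ b) + (top ∸ b′)
  upper {a} {b} {b′} mid = begin
    2 * (top ∸ a)                ≡⟨ *-distribˡ-∸ 2 top a ⟩
    2 * top ∸ 2 * a              ≤⟨ m≤n+o⇒m∸n≤o (2 * top) (2 * a) (begin
        2 * top                                    ≡⟨ cong (top +_) (+-identityʳ top) ⟩
        top + top                                  ≤⟨ +-mono-≤ (m≤n+m∸n top b) (m≤n+m∸n top b′) ⟩
        b + (top ∸ b) + (b′ + (top ∸ b′))          ≡⟨ shuffle b (top ∸ b) b′ (top ∸ b′) ⟩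
        b + b′ + ((top ∸ b) + (top ∸ b′))          ≡⟨ cong (_+ ((top ∸ b) + (top ∸ b′))) mid ⟩
        2 * a + ((top ∸ b) + (top ∸ b′))           ∎) ⟩
    (top ∸ b) + (top ∸ b′)       ∎
    where
    open ≤-Reasoning
    shuffle : ∀ b x c y → b + x + (c + y) ≡ b + c + (x + y)
    shuffle = solve-∀

  -- Both sides of the tent have slope at most 1 in absolute value, and adding `r` commutes with the
  -- minimum.
  u-lipschitz : ∀ {a b} → a ≤ b + r → b ≤ a + r → u a ≤ u b + r
  u-lipschitz {a} {b} a≤b+r b≤a+r = subst (u a ≤_) (≡-sym (+-distribʳ-⊓ r (b ∸ r) (top ∸ b)))
    (⊓-mono-≤ (m≤n+o⇒m∸n≤o a r (≤-trans a≤b+r (subst (b + r ≤_) (+-comm (b ∸ r + r) r) (+-monoˡ-≤ r (n≤r+n∸r b)))))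
              (m≤n+o⇒m∸n≤o top a (≤-trans (m≤n+m∸n top b) (≤-trans (+-monoˡ-≤ (top ∸ b) b≤a+r) (≤-reflexive (shuffle a r (top ∸ b)))))))
    where
    shuffle : ∀ a r x → a + r + x ≡ a + (x + r)
    shuffle = solve-∀

  u-left : ∀ {b} → b ≤ H → u b ≡ b ∸ r
  u-left {b} b≤H = m≤n⇒m⊓n≡m (≤-trans (m∸n≤m b r) (≤-trans b≤H (m+n≤o⇒m≤o∸n H
    (≤-trans (+-monoʳ-≤ H (≤-trans b≤H (m≤m+n H 0))) (m≤n+m (2 * H) 2)))))

  u-right : ∀ {b} → top ≤ b + H → H + r ≤ b → u b ≡ top ∸ b
  u-right {b} top≤ H+r≤b = m≥n⇒m⊓n≡n (≤-trans (m≤n+o⇒m∸n≤o top b top≤) (m+n≤o⇒m≤o∸n H H+r≤b))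

  -- `b` and `b′` are mirror images about `a`, so an upper bound for one is a lower bound for the
  -- other.
  a≤b+r : ∀ {a b b′} → b + b′ ≡ 2 * a → b′ ≤ a + r → a ≤ b + r
  a≤b+r {a} {b} {b′} mid b′≤ = +-cancelˡ-≤ a a (b + r) (begin
    a + a            ≡⟨ cong (a +_) (+-identityʳ a) ⟨
    2 * a            ≡⟨ mid ⟨
    b + b′           ≤⟨ +-monoʳ-≤ b b′≤ ⟩
    b + (a + r)      ≡⟨ shuffle b a r ⟩
    a + (b + r)      ∎)
    where
    open ≤-Reasoning
    shuffle : ∀ b a r → b + (a + r) ≡ a + (b + r)
    shuffle = solve-∀

  -- Away from the apex the tent is affine on the interval of radius r around a, as far as it is positive, and
  -- convex at its foot; near the apex a shift by r costs only a fraction 1 / suc E of its value.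
  u-midpoint : ∀ {a b b′} → b + b′ ≡ 2 * a → b ≤ a + r → b′ ≤ a + r → 2 * E * u a ≤ suc E * (u b + u b′)
  u-midpoint {a} {b} {b′} mid b≤ b′≤ with suc E * r ≤? u a
  ... | yes big = begin
    2 * E * u a                          ≡⟨ double E (u a) ⟩
    E * u a + E * u a                    ≤⟨ +-mono-≤ (high (a≤b+r {a} {b} {b′} mid b′≤) b≤) (high (a≤b+r {a} {b′} {b} (trans (+-comm b′ b) mid) b≤) b′≤) ⟩
    suc E * u b + suc E * u b′           ≡⟨ *-distribˡ-+ (suc E) (u b) (u b′) ⟨
    suc E * (u b + u b′)                 ∎
    where
    open ≤-Reasoning
    double : ∀ e x → 2 * e * x ≡ e * x + e * x
    double = solve-∀
    high : ∀ {b} → a ≤ b + r → b ≤ a + r → E * u a ≤ suc E * u b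
    high {b} p q = +-cancelʳ-≤ (suc E * r) _ _ (begin
      E * u a + suc E * r        ≤⟨ +-monoʳ-≤ (E * u a) big ⟩
      E * u a + u a              ≡⟨ +-comm (E * u a) (u a) ⟩
      suc E * u a                ≤⟨ *-monoʳ-≤ (suc E) (u-lipschitz p q) ⟩
      suc E * (u b + r)          ≡⟨ *-distribˡ-+ (suc E) (u b) r ⟩
      suc E * u b + suc E * r    ∎)
  ... | no ¬big = begin
    2 * E * u a                 ≤⟨ *-monoˡ-≤ (u a) (*-monoʳ-≤ 2 (n≤1+n E)) ⟩
    2 * suc E * u a             ≡⟨ shuffle (suc E) (u a) ⟩
    suc E * (2 * u a)           ≤⟨ *-monoʳ-≤ (suc E) (low (⊓-sel (a ∸ r) (top ∸ a))) ⟩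
    suc E * (u b + u b′)        ∎
    where
    open ≤-Reasoning
    shuffle : ∀ e x → 2 * e * x ≡ e * (2 * x)
    shuffle = solve-∀
    small : u a ≤ suc E * r
    small = <⇒≤ (≰⇒> ¬big)
    -- As `u a` is small, `a` is near the foot of the side that attains the minimum. By the choice
    -- of `H`, both neighbours lie where the same side is the smaller one, and its convexity
    -- applies.
    low : u a ≡ a ∸ r ⊎ u a ≡ top ∸ a → 2 * u a ≤ u b + u b′
    low (inj₁ left) = begin
      2 * u a                    ≡⟨ cong (2 *_) left ⟩
      2 * (a ∸ r)                ≤⟨ lower {a} {b} {b′} mid ⟩
      (b ∸ r) + (b′ ∸ r)         ≡⟨ cong₂ _+_ (u-left (b≤H b≤)) (u-left (b≤H b′≤)) ⟨
      u b + u b′                 ∎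
      where
      b≤H : ∀ {b} → b ≤ a + r → b ≤ H
      b≤H {b} b≤ = begin
        b                         ≤⟨ b≤ ⟩
        a + r                     ≤⟨ +-monoˡ-≤ r (n≤r+n∸r a) ⟩
        (a ∸ r) + r + r           ≤⟨ +-monoˡ-≤ r (+-monoˡ-≤ r (subst (_≤ suc E * r) left small)) ⟩
        suc E * r + r + r         ≡⟨ regroup (suc E * r) r ⟩
        H                         ∎
        where
        regroup : ∀ x r → x + r + r ≡ r + (r + x)
        regroup = solve-∀
    low (inj₂ right) = begin
      2 * u a                    ≡⟨ cong (2 *_) right ⟩
      2 * (top ∸ a)              ≤⟨ upper {a} {b} {b′} mid ⟩
      (top ∸ b) + (top ∸ b′)     ≡⟨ cong₂ _+_ (u-right′ (a≤b+r {a} {b} {b′} mid b′≤)) (u-right′ (a≤b+r {a} {b′} {b} (trans (+-comm b′ b) mid) b≤)) ⟨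
      u b + u b′                 ∎
      where
      top≤ : ∀ {b} → a ≤ b + r → top ≤ b + (r + suc E * r)
      top≤ {b} a≤ = begin
        top                       ≤⟨ m≤n+m∸n top a ⟩
        a + (top ∸ a)             ≤⟨ +-mono-≤ a≤ (subst (_≤ suc E * r) right small) ⟩
        b + r + suc E * r         ≡⟨ +-assoc b r (suc E * r) ⟩
        b + (r + suc E * r)       ∎
      u-right′ : ∀ {b} → a ≤ b + r → u b ≡ top ∸ b
      u-right′ {b} a≤ = u-right (≤-trans (top≤ a≤) (+-monoʳ-≤ b (m≤n+m _ r))) (+-cancelʳ-≤ (r + suc E * r) _ _ (begin
        H + r + (r + suc E * r)   ≡⟨ regroup H r (suc E * r) ⟩
        H + H                     ≡⟨ cong (H +_) (+-identityʳ H) ⟨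
        2 * H                     ≤⟨ m≤n+m (2 * H) 2 ⟩
        top                       ≤⟨ top≤ a≤ ⟩
        b + (r + suc E * r)       ∎))
        where
        regroup : ∀ h r x → h + r + (r + x) ≡ h + (r + (r + x))
        regroup = solve-∀

  module Symmetric (Q : ℕ → ℕ) (Q-sym : ∀ j → j ≤ r → Q (r ∸ j) ≡ Q j) where

    private
      js : List ℕ
      js = upTo (suc r)

    ΣQ : ℕ
    ΣQ = Σ js Q

    -- The parameters j and r - j move the level by opposite amounts r - 2j and 2j - r; `r ≤ a`
    -- excludes truncation.
    shift-mid : ∀ {a j} → r ≤ a → j ≤ r → (a + r ∸ 2 * j) + (a + r ∸ 2 * (r ∸ j)) ≡ 2 * a
    shift-mid {a} {j} r≤a j≤r with m≤n⇒∃[o]m+o≡n j≤r | m≤n⇒∃[o]m+o≡n r≤a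
    ... | i , refl | c , refl = begin
      (j + i + c + (j + i) ∸ 2 * j) + (j + i + c + (j + i) ∸ 2 * (j + i ∸ j))
        ≡⟨ cong₂ _+_ (cong (_∸ 2 * j) (pull j i c)) (trans (cong (λ k → j + i + c + (j + i) ∸ 2 * k) (m+n∸m≡n j i)) (cong (_∸ 2 * i) (pull′ j i c))) ⟩
      (2 * j + (2 * i + c) ∸ 2 * j) + (2 * i + (2 * j + c) ∸ 2 * i)
        ≡⟨ cong₂ _+_ (m+n∸m≡n (2 * j) (2 * i + c)) (m+n∸m≡n (2 * i) (2 * j + c)) ⟩
      2 * i + c + (2 * j + c)
        ≡⟨ total j i c ⟩
      2 * (j + i + c) ∎
      where
      open ≡-Reasoning
      pull : ∀ j i c → j + i + c + (j + i) ≡ 2 * j + (2 * i + c)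
      pull = solve-∀
      pull′ : ∀ j i c → j + i + c + (j + i) ≡ 2 * i + (2 * j + c)
      pull′ = solve-∀
      total : ∀ j i c → 2 * i + c + (2 * j + c) ≡ 2 * (j + i + c)
      total = solve-∀

    -- From each inner sum only the level a + r - 2j is kept; it lies in the window because `a` is
    -- below `top`.
    shift-sum : ∀ {a} → r ≤ a → a <ℕ top → Σ js (λ j → Q j * u (a + r ∸ 2 * j)) ≤ apply levels (toeplitz r Q) u a
    shift-sum {a} r≤a a<top = subst (Σ js (λ j → Q j * u (a + r ∸ 2 * j)) ≤_) (≡-sym (apply-toeplitz levels r Q u a)) (Σ-mono js λ {j} j∈ → begin
      Q j * u (a + r ∸ 2 * j)
        ≡⟨ cong (_* u (a + r ∸ 2 * j)) (entry-≡ {r} {Q} {a} {a + r ∸ 2 * j} {j} (m∸n+n≡m (2j≤ (≤-pred (∈-upTo⁻ j∈))))) ⟨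
      entry r Q a (a + r ∸ 2 * j) j * u (a + r ∸ 2 * j)
        ≤⟨ Σ-member (λ b → entry r Q a b j * u b) (∈-upTo⁺ {levels} (≤-<-trans (m∸n≤m (a + r) (2 * j)) (+-monoˡ-< r a<top))) ⟩
      Σ (upTo levels) (λ b → entry r Q a b j * u b) ∎)
      where
      open ≤-Reasoning
      2j≤ : ∀ {j} → j ≤ r → 2 * j ≤ a + r
      2j≤ {j} j≤r = +-mono-≤ (≤-trans j≤r r≤a) (≤-trans (≤-reflexive (+-identityʳ j)) j≤r)

    -- Off the support of the tent the left side is zero. On it, the doubled sum pairs j with r - j:
    -- by symmetry of `Q` both carry the same weight, and their targets are centred at `a`, so
    -- `u-midpoint` gives the eigenvalue `ΣQ` up to the factor E / (E + 1).
    u-eigen : ∀ a → E * ΣQ * u a ≤ suc E * apply levels (toeplitz r Q) u a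
    u-eigen a with r ≤? a | a <? top
    ... | no r≰a | _ rewrite m≤n⇒m∸n≡0 (<⇒≤ (≰⇒> r≰a)) = ≤-trans (≤-reflexive (*-zeroʳ (E * ΣQ))) z≤n
    ... | yes _ | no a≮top rewrite m≤n⇒m∸n≡0 (≮⇒≥ a≮top) | ⊓-zeroʳ (a ∸ r) = ≤-trans (≤-reflexive (*-zeroʳ (E * ΣQ))) z≤n
    ... | yes r≤a | yes a<top = *-cancelˡ-≤ 2 (begin
      2 * (E * ΣQ * u a)                                       ≡⟨ shuffle E ΣQ (u a) ⟩
      ΣQ * (2 * E * u a)                                       ≡⟨ Σ-*ʳ js (2 * E * u a) Q ⟨
      Σ js (λ j → Q j * (2 * E * u a))                         ≤⟨ Σ-mono js (λ {j} j∈ → *-monoʳ-≤ (Q j) (u-midpoint (shift-mid r≤a (≤-pred (∈-upTo⁻ j∈))) (m∸n≤m _ (2 * j)) (m∸n≤m _ (2 * (r ∸ j))))) ⟩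
      Σ js (λ j → Q j * (suc E * (v j + v (r ∸ j))))           ≡⟨ Σ-cong js (λ {j} j∈ → distribute (Q j) (suc E) (v j) (v (r ∸ j)) (≡-sym (Q-sym j (≤-pred (∈-upTo⁻ j∈))))) ⟩
      Σ js (λ j → suc E * (Q j * v j + Q (r ∸ j) * v (r ∸ j))) ≡⟨ Σ-*ˡ js (suc E) (λ j → Q j * v j + Q (r ∸ j) * v (r ∸ j)) ⟩
      suc E * Σ js (λ j → Q j * v j + Q (r ∸ j) * v (r ∸ j))   ≡⟨ cong (suc E *_) (Σ-+ js (λ j → Q j * v j) (λ j → Q (r ∸ j) * v (r ∸ j))) ⟩
      suc E * (V + Σ js (λ j → Q (r ∸ j) * v (r ∸ j)))         ≡⟨ cong (λ s → suc E * (V + s)) (Σ-reverse r (λ j → Q j * v j)) ⟩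
      suc E * (V + V)                                          ≤⟨ *-monoʳ-≤ (suc E) (+-mono-≤ (shift-sum r≤a a<top) (shift-sum r≤a a<top)) ⟩
      suc E * (W + W)                                          ≡⟨ collect (suc E) W ⟩
      2 * (suc E * W)                                          ∎)
      where
      open ≤-Reasoning
      v : ℕ → ℕ
      v j = u (a + r ∸ 2 * j)
      V = Σ js (λ j → Q j * v j)
      W = apply levels (toeplitz r Q) u a
      shuffle : ∀ e s x → 2 * (e * s * x) ≡ s * (2 * e * x)
      shuffle = solve-∀
      collect : ∀ e w → e * (w + w) ≡ 2 * (e * w)
      collect = solve-∀
      distribute′ : ∀ q e x y → q * (e * (x + y)) ≡ e * (q * x + q * y)
      distribute′ = solve-∀
      distribute : ∀ q e x y {q′} → q ≡ q′ → q * (e * (x + y)) ≡ e * (q * x + q′ * y)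
      distribute q e x y refl = distribute′ q e x y

    -- Iterates `u-eigen`; the induction starts from the bound of the tent by `top` times `𝟙`.
    u-pow : ∀ m a → (E * ΣQ) ^ m * u a ≤ suc E ^ m * (top * pow levels (toeplitz r Q) m 𝟙 a)
    u-pow zero    a = ≤-trans (≤-reflexive (+-identityʳ (u a))) (≤-trans (u≤top a)
                        (≤-reflexive (≡-sym (trans (+-identityʳ (top * 1)) (*-identityʳ top)))))
    u-pow (suc m) a = begin
      E * ΣQ * (E * ΣQ) ^ m * u a                                ≡⟨ shuffle₁ (E * ΣQ) ((E * ΣQ) ^ m) (u a) ⟩
      (E * ΣQ) ^ m * (E * ΣQ * u a)                              ≤⟨ *-monoʳ-≤ ((E * ΣQ) ^ m) (u-eigen a) ⟩
      (E * ΣQ) ^ m * (suc E * apply levels M u a)                ≡⟨ shuffle₂ ((E * ΣQ) ^ m) (suc E) (apply levels M u a) ⟩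
      suc E * ((E * ΣQ) ^ m * apply levels M u a)                ≡⟨ cong (suc E *_) (Σ-*ˡ (upTo levels) ((E * ΣQ) ^ m) (λ b → M a b * u b)) ⟨
      suc E * Σ (upTo levels) (λ b → (E * ΣQ) ^ m * (M a b * u b))  ≤⟨ *-monoʳ-≤ (suc E) (Σ-mono (upTo levels) (λ {b} _ → step b)) ⟩
      suc E * Σ (upTo levels) (λ b → suc E ^ m * top * (M a b * F b))  ≡⟨ cong (suc E *_) (Σ-*ˡ (upTo levels) (suc E ^ m * top) (λ b → M a b * F b)) ⟩
      suc E * (suc E ^ m * top * pow levels M (suc m) 𝟙 a)       ≡⟨ shuffle₄ (suc E) (suc E ^ m) top _ ⟩
      suc E * suc E ^ m * (top * pow levels M (suc m) 𝟙 a)       ∎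
      where
      open ≤-Reasoning
      M = toeplitz r Q
      F = pow levels M m 𝟙
      shuffle₁ : ∀ e p x → e * p * x ≡ p * (e * x)
      shuffle₁ = solve-∀
      shuffle₂ : ∀ p e x → p * (e * x) ≡ e * (p * x)
      shuffle₂ = solve-∀
      shuffle₃ : ∀ p x t y → x * (p * (t * y)) ≡ p * t * (x * y)
      shuffle₃ = solve-∀
      shuffle₄ : ∀ e p t x → e * (p * t * x) ≡ e * p * (t * x)
      shuffle₄ = solve-∀
      step : ∀ b → (E * ΣQ) ^ m * (M a b * u b) ≤ suc E ^ m * top * (M a b * F b)
      step b = begin
        (E * ΣQ) ^ m * (M a b * u b)           ≡⟨ shuffle₂ ((E * ΣQ) ^ m) (M a b) (u b) ⟩
        M a b * ((E * ΣQ) ^ m * u b)           ≤⟨ *-monoʳ-≤ (M a b) (u-pow m b) ⟩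
        M a b * (suc E ^ m * (top * F b))      ≡⟨ shuffle₃ (suc E ^ m) (M a b) top (F b) ⟩
        suc E ^ m * top * (M a b * F b)        ∎

    -- Read off at level `suc r`, where the tent is at least 1; the value there is one term of the
    -- total.
    Σ-pow-lower : ∀ m → (E * ΣQ) ^ m ≤ suc E ^ m * (top * Σ (upTo levels) (pow levels (toeplitz r Q) m 𝟙))
    Σ-pow-lower m = begin
      (E * ΣQ) ^ m                                                   ≡⟨ *-identityʳ _ ⟨
      (E * ΣQ) ^ m * 1                                               ≤⟨ *-monoʳ-≤ ((E * ΣQ) ^ m) u-suc-r ⟩
      (E * ΣQ) ^ m * u (suc r)                                       ≤⟨ u-pow m (suc r) ⟩
      suc E ^ m * (top * F (suc r))                                  ≤⟨ *-monoʳ-≤ (suc E ^ m) (*-monoʳ-≤ top (Σ-member F (∈-upTo⁺ {levels} (s≤s (s≤s (m≤n+m r _)))))) ⟩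
      suc E ^ m * (top * Σ (upTo levels) F)                          ∎
      where
      open ≤-Reasoning
      F = pow levels (toeplitz r Q) m 𝟙

-- Walks in graphs

module _ {n : ℕ} (G : Graph n) where

  -- Distance at most `i` as an inductive family. Steps are added at the front, whereas `within`
  -- grows at the far end, and `stay` at every index builds in monotonicity.
  data Reach : ℕ → Fin n → Fin n → Set where
    stay : ∀ {i u} → Reach i u u
    step : ∀ {i u w v} → adj G u w ≡ true → Reach i w v → Reach (suc i) u v

  adj-sym : ∀ {u v} → adj G u v ≡ true → adj G v u ≡ true
  adj-sym {u} {v} = trans (sym G v u)

  reach-mono : ∀ {i j u v} → i ≤ j → Reach i u v → Reach j u v
  reach-mono i≤j       stay       = stay
  reach-mono (s≤s i≤j) (step a p) = step a (reach-mono i≤j p)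

  reach-trans : ∀ {i j u v w} → Reach i u v → Reach j v w → Reach (i + j) u w
  reach-trans {i} {j} stay q = reach-mono (m≤n+m j i) q
  reach-trans (step a p)   q = step a (reach-trans p q)

  reach-snoc : ∀ {i u v w} → Reach i u v → adj G v w ≡ true → Reach (suc i) u w
  reach-snoc {i} p a = reach-mono (≤-reflexive (+-comm i 1)) (reach-trans p (step {0} a stay))

  reach-sym : ∀ {i u v} → Reach i u v → Reach i v u
  reach-sym stay       = stay
  reach-sym (step a p) = reach-snoc (reach-sym p) (adj-sym a)

  within-refl : ∀ i u → within G i u u ≡ true
  within-refl zero    u with u ≟ᶠ u
  ... | yes _ = refl
  ... | no ¬p = contradiction refl ¬p
  within-refl (suc i) u rewrite within-refl i u = refl

  within-snoc : ∀ i {u w v} → within G i u w ≡ true → adj G w v ≡ true → within G (suc i) u v ≡ true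
  within-snoc i {u} {w} {v} p a = Equivalence.to T-≡ (Equivalence.from T-∨ (inj₂ (any⁺ _
    (Any.map (λ { refl → Equivalence.from T-∧ (Equivalence.from T-≡ p , Equivalence.from T-≡ a) }) (∈-allFin w)))))

  within-suc⁻ : ∀ i {u v} → within G (suc i) u v ≡ true →
                within G i u v ≡ true ⊎ (∃[ w ] (within G i u w ≡ true × adj G w v ≡ true))
  within-suc⁻ i h with Equivalence.to T-∨ (Equivalence.from T-≡ h)
  ... | inj₁ p = inj₁ (Equivalence.to T-≡ p)
  ... | inj₂ p with Any.satisfied (any⁻ _ (allFin n) p)
  ...   | w , q with Equivalence.to T-∧ q
  ...     | q₁ , q₂ = inj₂ (w , Equivalence.to T-≡ q₁ , Equivalence.to T-≡ q₂)

  within-zero⁻ : ∀ {u v} → within G 0 u v ≡ true → u ≡ v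
  within-zero⁻ {u} {v} h with u ≟ᶠ v
  ... | yes p = p

  within⇒reach : ∀ i {u v} → within G i u v ≡ true → Reach i u v
  within⇒reach zero    h with refl ← within-zero⁻ h = stay
  within⇒reach (suc i) h with within-suc⁻ i h
  ... | inj₁ p           = reach-mono (n≤1+n i) (within⇒reach i p)
  ... | inj₂ (w , p , a) = reach-snoc (within⇒reach i p) a

  within-suc⁺ : ∀ i {u v} → within G i u v ≡ true → within G (suc i) u v ≡ true
  within-suc⁺ i h rewrite h = refl

  within-cons : ∀ i {u w v} → adj G u w ≡ true → within G i w v ≡ true → within G (suc i) u v ≡ true
  within-cons zero    {u} a h with refl ← within-zero⁻ h = within-snoc zero (within-refl 0 u) a
  within-cons (suc i) a h with within-suc⁻ i h
  ... | inj₁ p           = within-suc⁺ (suc i) (within-cons i a p)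
  ... | inj₂ (w , p , b) = within-snoc (suc i) (within-cons i a p) b

  reach⇒within : ∀ {i u v} → Reach i u v → within G i u v ≡ true
  reach⇒within {i} {u} stay   = within-refl i u
  reach⇒within {suc i} (step a p) = within-cons i a (reach⇒within p)

  distEq⇒reach : ∀ i {u v} → distEq G i u v ≡ true → Reach i u v
  distEq⇒reach zero    h = within⇒reach 0 h
  distEq⇒reach (suc i) h = within⇒reach (suc i) (Equivalence.to T-≡ (proj₁ (Equivalence.to T-∧ (Equivalence.from T-≡ h))))

  distGe⇒¬reach : ∀ i {u v} → distGe G (suc i) u v ≡ true → ¬ Reach i u v
  distGe⇒¬reach i h p rewrite reach⇒within p = contradiction h λ ()

  -- The last vertex but one of a shortest path: were it any nearer to `u`, then `v` would be too
  -- near as well.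
  distEq-pred : ∀ i {u v} → distEq G (suc i) u v ≡ true → ∃[ w ] (distEq G i u w ≡ true × adj G w v ≡ true)
  distEq-pred i {u} {v} h with Equivalence.to T-∧ (Equivalence.from T-≡ h)
  ... | near , far with within-suc⁻ i (Equivalence.to T-≡ near) | Equivalence.to T-not-≡ far
  ...   | inj₁ p           | ¬p = contradiction (trans (≡-sym p) ¬p) λ ()
  ...   | inj₂ (w , p , a) | ¬p = w , exact i p ¬p , a
    where
    exact : ∀ i → within G i u w ≡ true → within G i u v ≡ false → distEq G i u w ≡ true
    exact zero    p ¬p = p
    exact (suc i) p ¬p with within G i u w in eq
    ... | false = Equivalence.to T-≡ (Equivalence.from T-∧ (Equivalence.from T-≡ p , tt))
    ... | true  = contradiction (trans (≡-sym (within-snoc i eq a)) ¬p) λ ()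

  -- Merely an infinite walk: vertices may repeat, and nothing geodesic is asked.
  Ray : (ℕ → Fin n) → Set
  Ray p = ∀ i → adj G (p i) (p (suc i)) ≡ true

  ray-reach : ∀ {p} → Ray p → ∀ i j → Reach j (p i) (p (i + j))
  ray-reach {p} ray i zero    = subst (λ k → Reach 0 (p i) (p k)) (≡-sym (+-identityʳ i)) stay
  ray-reach {p} ray i (suc j) = subst (λ k → Reach (suc j) (p i) (p k)) (≡-sym (+-suc i j)) (step (ray i) (ray-reach ray (suc i) j))

  -- A shortest path from `p 0` to `w`, traversed backwards, is put in front of the ray.
  extend-ray : ∀ {p} → Ray p → ∀ l {w} → distEq G l (p 0) w ≡ true →
               ∃[ p′ ] (Ray p′ × p′ 0 ≡ w × (∀ i → p′ (l + i) ≡ p i))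
  extend-ray {p} ray zero    h = p , ray , within-zero⁻ h , λ _ → refl
  extend-ray {p} ray (suc l) {w} h with distEq-pred l h
  ... | w′ , h′ , a with extend-ray ray l h′
  ...   | p′ , ray′ , start , tail = p″ , ray″ , refl , tail
    where
    p″ : ℕ → Fin n
    p″ zero    = w
    p″ (suc i) = p′ i
    ray″ : Ray p″
    ray″ zero    = subst (λ v → adj G w v ≡ true) (≡-sym start) (adj-sym a)
    ray″ (suc i) = ray′ i

  -- The ones on the diagonal of `Apow` pad a path to exactly `i` steps, and `1 ≤ r` makes every
  -- edge of `G` a step.
  reach⇒walk : ∀ {r} → 1 ≤ r → ∀ {i u v} → Reach i u v → 1 ≤ walks G r i u v
  reach⇒walk 1≤r {zero} {u} stay with u ≟ᶠ u
  ... | yes _ = ≤-refl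
  ... | no ¬p = contradiction refl ¬p
  reach⇒walk {r} 1≤r {suc i} {u} stay = begin
    1                                                           ≤⟨ reach⇒walk {r} 1≤r {i} {u} stay ⟩
    walks G r i u u                                             ≡⟨ *-identityˡ _ ⟨
    1 * walks G r i u u                                         ≡⟨ cong (λ b → (if b then 1 else 0) * walks G r i u u) (within-refl r u) ⟨
    Apow G r u u * walks G r i u u                              ≤⟨ Σ-member (λ w → Apow G r u w * walks G r i w u) (∈-allFin u) ⟩
    walks G r (suc i) u u                                       ∎
    where open ≤-Reasoning
  reach⇒walk {r} 1≤r {suc i} {u} {v} (step {w = w} a p) = begin
    1                                                           ≤⟨ reach⇒walk {r} 1≤r p ⟩
    walks G r i w v                                             ≡⟨ *-identityˡ _ ⟨
    1 * walks G r i w v                                         ≡⟨ cong (λ b → (if b then 1 else 0) * walks G r i w v) (reach⇒within (reach-mono 1≤r (step {0} a stay))) ⟨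
    Apow G r u w * walks G r i w v                              ≤⟨ Σ-member (λ w → Apow G r u w * walks G r i w v) (∈-allFin w) ⟩
    walks G r (suc i) u v                                       ∎
    where open ≤-Reasoning

  -- The condition counted by `deltaAt`: moving away from `x` by `i` without coming closer than `i`
  -- to `y`.
  branch : ℕ → Fin n → Fin n → Fin n → Bool
  branch i x y v = distEq G i x v ∧ distGe G i y v

  branch⁻ : ∀ i {x y v} → branch i x y v ≡ true → distEq G i x v ≡ true × distGe G i y v ≡ true
  branch⁻ i h with Equivalence.to T-∧ (Equivalence.from T-≡ h)
  ... | p , q = Equivalence.to T-≡ p , Equivalence.to T-≡ q

  -- The distance from p i to w plus i is nondecreasing in i, equals r at each admissible j and exceeds r just after it.
  branch-disjoint : ∀ {p} → Ray p → ∀ r {j k w} → j <ℕ k → k ≤ r →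
    branch (r ∸ j) (p j) (p (suc j)) w ≡ true → branch (r ∸ k) (p k) (p (suc k)) w ≡ true → ⊥
  branch-disjoint {p} ray r {j} {k} {w} j<k k≤r hj hk with m≤n⇒∃[o]m+o≡n j<k
  ... | i , refl with m≤n⇒∃[o]m+o≡n k≤r
  -- With k = j + 1 + i and r = k + l, the ray leads from `p (suc j)` to p k, and from there `w` is
  -- reached after i + l = r - j - 1 steps in all, one fewer than `distGe` permits.
  ...   | l , refl = distGe⇒¬reach (i + l) (subst (λ m → distGe G m (p (suc j)) w ≡ true) gap (proj₂ (branch⁻ (r ∸ j) hj)))
                       (subst (λ m → Reach (i + m) (p (suc j)) w) (m+n∸m≡n (suc j + i) l)
                         (reach-trans (ray-reach ray (suc j) i) (distEq⇒reach (r ∸ (suc j + i)) (proj₁ (branch⁻ (r ∸ (suc j + i)) hk)))))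
    where
    gap : suc j + i + l ∸ j ≡ suc (i + l)
    gap = trans (cong (_∸ j) (shuffle j i l)) (m+n∸m≡n j (suc (i + l)))
      where
      shuffle : ∀ j i l → suc j + i + l ≡ j + suc (i + l)
      shuffle = solve-∀

  -- While the level a is nonnegative, the vertex z at depth a + r of the ray is never removed, so the walk stays close to z.
  module Stack (r : ℕ) (1≤r : 1 ≤ r) (d : ℕ → ℕ)
               (d≤ : ∀ {j x y} → j ≤ r → adj G x y ≡ true → d j ≤ deltaAt G j x y)
               (N e : ℕ) (x z : Fin n) (return : ∀ {y} → Reach (N + r) y z → Reach e y x) where

    weight : ℕ → ℕ
    weight j = d (r ∸ j)

    M : ℕ → ℕ → ℕ
    M = toeplitz r weight

    -- Induction on the number of steps, with the invariant that `z` sits at depth `a + r` of the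
    -- current ray. The lattice steps are first matched with vertices for each `j`, then collected
    -- by vertex. When no steps remain, the current vertex is within `N + r` of `z`, and `return`
    -- closes the walk.
    walks-lower : ∀ m p a → Ray p → p (a + r) ≡ z → a <ℕ N → pow N M m 𝟙 a ≤ walks G r (m + e) (p 0) x
    walks-lower zero    p a ray base a<N = reach⇒walk {r} 1≤r (return
      (reach-mono (+-monoˡ-≤ r (<⇒≤ a<N)) (subst (Reach (a + r) (p 0)) base (ray-reach ray 0 (a + r)))))
    walks-lower (suc m) p a ray base a<N = begin
      apply N M F a                                                     ≡⟨ apply-toeplitz N r weight F a ⟩
      Σ (upTo (suc r)) (λ j → Σ (upTo N) (λ b → entry r weight a b j * F b)) ≤⟨ Σ-mono (upTo (suc r)) (λ j∈ → by-branch (≤-pred (∈-upTo⁻ j∈))) ⟩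
      Σ (upTo (suc r)) (λ j → Σ (allFin n) (λ w → g j w * C w))         ≡⟨ Σ-swap (upTo (suc r)) (allFin n) (λ j w → g j w * C w) ⟩
      Σ (allFin n) (λ w → Σ (upTo (suc r)) (λ j → g j w * C w))         ≤⟨ Σ-mono (allFin n) (λ {w} _ → by-vertex w) ⟩
      Σ (allFin n) (λ w → Apow G r (p 0) w * C w)                       ∎
      where
      open ≤-Reasoning
      F = pow N M m 𝟙

      C : Fin n → ℕ
      C w = walks G r (m + e) w x

      g : ℕ → Fin n → ℕ
      g j w = if branch (r ∸ j) (p j) (p (suc j)) w then 1 else 0

      C≥ : ∀ {j b w} → j ≤ r → b <ℕ N → b + 2 * j ≡ a + r → branch (r ∸ j) (p j) (p (suc j)) w ≡ true → F b ≤ C w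
      C≥ {j} {b} {w} j≤r b<N level h
        with extend-ray {λ i → p (j + i)} (λ i → subst (λ k → adj G (p (j + i)) (p k) ≡ true) (≡-sym (+-suc j i)) (ray (j + i)))
                        (r ∸ j) (subst (λ k → distEq G (r ∸ j) (p k) w ≡ true) (≡-sym (+-identityʳ j)) (proj₁ (branch⁻ (r ∸ j) h)))
      ... | p′ , ray′ , refl , tail = walks-lower m p′ b ray′ base′ b<N
        where
        -- Dropping the first j edges leaves `z` at depth a + r - j = b + j, and the new path adds r
        -- - j.
        depth : b + r ≡ r ∸ j + (b + j)
        depth = trans (cong (b +_) (≡-sym (m∸n+n≡m j≤r))) (shuffle b (r ∸ j) j)
          where
          shuffle : ∀ b x j → b + (x + j) ≡ x + (b + j)
          shuffle = solve-∀
        depth′ : j + (b + j) ≡ a + r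
        depth′ = trans (shuffle b j) level
          where
          shuffle : ∀ b j → j + (b + j) ≡ b + 2 * j
          shuffle = solve-∀
        base′ : p′ (b + r) ≡ z
        base′ = trans (cong p′ depth) (trans (tail (b + j)) (trans (cong p depth′) base))

      by-branch : ∀ {j} → j ≤ r → Σ (upTo N) (λ b → entry r weight a b j * F b) ≤ Σ (allFin n) (λ w → g j w * C w)
      -- For fixed `j` the level equation has only one solution `b`.
      by-branch {j} j≤r = Σ-single (upTo⁺ N) (λ {b} b∈ → bound b (∈-upTo⁻ b∈)) (λ {b} {c} _ _ → unique b c)
        where
        bound : ∀ b → b <ℕ N → entry r weight a b j * F b ≤ Σ (allFin n) (λ w → g j w * C w)
        bound b b<N with b + 2 * j ≟ a + r
        ... | no _      = z≤n
        ... | yes level = begin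
          -- The sum of `g j` is `deltaAt` at the edge from `p j` to `p (suc j)`, hence at least
          -- `d (r ∸ j)`.
          d (r ∸ j) * F b                          ≤⟨ *-monoˡ-≤ (F b) (d≤ (m∸n≤m r j) (ray j)) ⟩
          Σ (allFin n) (g j) * F b                 ≡⟨ Σ-*ʳ (allFin n) (F b) (g j) ⟨
          Σ (allFin n) (λ w → g j w * F b)         ≤⟨ Σ-mono (allFin n) (λ {w} _ → each w) ⟩
          Σ (allFin n) (λ w → g j w * C w)         ∎
          where
          each : ∀ w → g j w * F b ≤ g j w * C w
          each w with branch (r ∸ j) (p j) (p (suc j)) w in h
          ... | true  = *-monoʳ-≤ 1 (C≥ j≤r b<N level h)
          ... | false = z≤n
        unique : ∀ b c → entry r weight a b j * F b ≢ 0 → entry r weight a c j * F c ≢ 0 → b ≡ c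
        unique b c hb hc with b + 2 * j ≟ a + r | c + 2 * j ≟ a + r
        ... | yes p | yes q = +-cancelʳ-≡ (2 * j) b c (trans p (≡-sym q))
        ... | no  _ | _     = contradiction refl hb
        ... | yes _ | no _  = contradiction refl hc

      by-vertex : ∀ w → Σ (upTo (suc r)) (λ j → g j w * C w) ≤ Apow G r (p 0) w * C w
      by-vertex w = Σ-single (upTo⁺ (suc r)) (λ {j} j∈ → *-monoˡ-≤ (C w) (adjacent j (≤-pred (∈-upTo⁻ j∈))))
                             (λ {j} {k} j∈ k∈ → unique j k (≤-pred (∈-upTo⁻ j∈)) (≤-pred (∈-upTo⁻ k∈)))
        where
        adjacent : ∀ j → j ≤ r → g j w ≤ Apow G r (p 0) w
        adjacent j j≤r with branch (r ∸ j) (p j) (p (suc j)) w in h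
        ... | false = z≤n
        -- j edges along the ray and r - j more to `w` give distance at most r, that is, one step of
        -- the walk.
        ... | true  = ≤-reflexive (≡-sym (cong (λ b → if b then 1 else 0) (reach⇒within (subst (λ k → Reach k (p 0) w) (m+[n∸m]≡n j≤r)
                        (reach-trans (ray-reach ray 0 j) (distEq⇒reach (r ∸ j) (proj₁ (branch⁻ (r ∸ j) h))))))))
        unique : ∀ j k → j ≤ r → k ≤ r → g j w * C w ≢ 0 → g k w * C w ≢ 0 → j ≡ k
        unique j k j≤r k≤r hj hk with branch (r ∸ j) (p j) (p (suc j)) w in bj | branch (r ∸ k) (p k) (p (suc k)) w in bk
        ... | false | _     = contradiction refl hj
        ... | true  | false = contradiction refl hk
        ... | true  | true  with <-cmp j k
        ...   | tri< j<k _ _ = ⊥-elim (branch-disjoint ray r j<k k≤r bj bk)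
        ...   | tri≈ _ j≡k _ = j≡k
        ...   | tri> _ _ k<j = ⊥-elim (branch-disjoint ray r k<j j≤r bk bj)

-- The minima δ and t

listMin-≤ : ∀ {xs x} → x ∈ xs → listMin xs ≤ x
listMin-≤ {y ∷ ys} (here refl) = foldr-≤ ys
  where
  foldr-≤ : ∀ ys → foldr _⊓_ y ys ≤ y
  foldr-≤ []       = ≤-refl
  foldr-≤ (z ∷ zs) = ≤-trans (m⊓n≤n z _) (foldr-≤ zs)
listMin-≤ {y ∷ ys} (there x∈) = foldr-≤ x∈
  where
  foldr-≤ : ∀ {x ys} → x ∈ ys → foldr _⊓_ y ys ≤ x
  foldr-≤ {ys = z ∷ zs} (here refl) = m⊓n≤m z _
  foldr-≤ {ys = z ∷ zs} (there x∈)  = ≤-trans (m⊓n≤n z _) (foldr-≤ x∈)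

listMin-sel : ∀ x xs → listMin (x ∷ xs) ∈ x ∷ xs
listMin-sel x []       = here refl
listMin-sel x (y ∷ ys) with ⊓-sel y (foldr _⊓_ x ys) | listMin-sel x ys
... | inj₁ p | _        rewrite p = there (here refl)
... | inj₂ p | here  q  rewrite p = here q
... | inj₂ p | there q  rewrite p = there (there q)

δ-≤ : ∀ {n} (G : Graph n) i {x y} → adj G x y ≡ true → δ G i ≤ deltaAt G i x y
δ-≤ {n} G i {x} {y} a = listMin-≤ (∈-concatMap⁺ _ (Any.map (λ { refl → ∈-concatMap⁺ _ (Any.map (λ { refl → row }) (∈-allFin y)) }) (∈-allFin x)))
  where
  row : deltaAt G i x y ∈ (if adj G x y then deltaAt G i x y ∷ [] else [])
  row rewrite a = here refl

t-sel : ∀ {n} (G : Graph n) r k → 2 ≤ n → ∃[ x ] t G r k ≡ walks G r (2 * k) x x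
t-sel {suc n} G r k _ with ∈-map⁻ (λ x → walks G r (2 * k) x x) (listMin-sel (walks G r (2 * k) zero zero) (map (λ x → walks G r (2 * k) x x) (tabulate suc)))
... | x , _ , p = x , p

neighbour : ∀ {n} (G : Graph n) → 2 ≤ n → Connected G → ∀ x → ∃[ y ] adj G x y ≡ true
neighbour G (s≤s (s≤s _)) connected x with other x
  where
  other : ∀ {n} (x : Fin (suc (suc n))) → ∃[ y ] x ≢ y
  other zero    = suc zero , λ ()
  other (suc _) = zero , λ ()
... | y , x≢y with connected x y
...   | i , h with within⇒reach G i h
...     | stay     = contradiction refl x≢y
...     | step a _ = _ , a

-- Every starting level in the window is served by the same ray, which bounces along one edge at
-- `x`; only the depth of the anchor vertex changes. The closing length depends on `N` and `r`
-- alone, not on the graph.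
walks-level-lower : ∀ {n} (G : Graph n) → 2 ≤ n → Connected G → ∀ r → 1 ≤ r →
  (d : ℕ → ℕ) → (∀ j → j ≤ r → δ G j ≡ d j) → ∀ N m x →
  Σ (upTo N) (pow N (toeplitz r (λ j → d (r ∸ j))) m 𝟙) ≤ N * walks G r (m + (N + r + (N + r))) x x
walks-level-lower {n} G 2≤n connected r 1≤r d δ≡d N m x with neighbour G 2≤n connected x
... | y , a = subst (_ ≤_) (Σ-const N _) (Σ-mono (upTo N) λ {l} l∈ → level l (∈-upTo⁻ l∈))
  where
  ray : ℕ → Fin n
  ray zero          = x
  ray (suc zero)    = y
  ray (suc (suc i)) = ray i

  is-ray : Ray G ray
  is-ray zero          = a
  is-ray (suc zero)    = adj-sym G a
  is-ray (suc (suc i)) = is-ray i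

  level : ∀ l → l <ℕ N → pow N (toeplitz r (λ j → d (r ∸ j))) m 𝟙 l ≤ walks G r (m + (N + r + (N + r))) x x
  level l l<N = Stack.walks-lower G r 1≤r d
    (λ {j} j≤r a → subst (_≤ _) (δ≡d j j≤r) (δ-≤ G j a)) N (N + r + (N + r)) x (ray (l + r))
    -- At most `N + r` steps to the anchor `ray (l + r)`, then at most `N + r` back along the ray to
    -- `x`.
    (λ q → reach-trans G q (reach-mono G (+-monoˡ-≤ r (<⇒≤ l<N)) (reach-sym G (ray-reach G is-ray 0 (l + r)))))
    m ray l is-ray refl l<N

-- The inequality in natural numbers

^-distribʳ-* : ∀ k m n → (m * n) ^ k ≡ m ^ k * n ^ k
^-distribʳ-* zero    m n = refl
^-distribʳ-* (suc k) m n rewrite ^-distribʳ-* k m n = *-interchange m n (m ^ k) (n ^ k)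

-- Bernoulli's inequality (1 + 1/E)^L ≥ 1 + L/E with denominators cleared.
bernoulli : ∀ E L → E ^ L * (E + L) ≤ E * suc E ^ L
bernoulli E zero    = ≤-reflexive (trans (*-identityˡ _) (trans (+-identityʳ E) (≡-sym (*-identityʳ E))))
bernoulli E (suc L) = begin
  E * E ^ L * (E + suc L)           ≤⟨ m≤m+n _ _ ⟩
  E * E ^ L * (E + suc L) + E ^ L * L   ≡⟨ shuffle₁ E (E ^ L) L ⟩
  suc E * (E ^ L * (E + L))         ≤⟨ *-monoʳ-≤ (suc E) (bernoulli E L) ⟩
  suc E * (E * suc E ^ L)           ≡⟨ shuffle₂ (suc E) E (suc E ^ L) ⟩
  E * (suc E * suc E ^ L)           ∎
  where
  open ≤-Reasoning
  shuffle₁ : ∀ e p l → e * p * (e + suc l) + p * l ≡ suc e * (p * (e + l))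
  shuffle₁ = solve-∀
  shuffle₂ : ∀ a b c → a * (b * c) ≡ b * (a * c)
  shuffle₂ = solve-∀

bernoulli-absorb : ∀ E .{{_ : NonZero E}} X L → X * E ≤ L → X * E ^ L ≤ suc E ^ L
bernoulli-absorb E X L h = *-cancelˡ-≤ E (begin
  E * (X * E ^ L)      ≡⟨ shuffle E X (E ^ L) ⟩
  E ^ L * (X * E)      ≤⟨ *-monoʳ-≤ (E ^ L) (≤-trans h (m≤n+m L E)) ⟩
  E ^ L * (E + L)      ≤⟨ bernoulli E L ⟩
  E * suc E ^ L        ∎)
  where
  open ≤-Reasoning
  shuffle : ∀ e x p → e * (x * p) ≡ p * (x * e)
  shuffle = solve-∀

-- With E = 2c + 1 one has c / (c + 1) ≤ (E / (E + 1))², so one factor E / (E + 1) per step is left to absorb the constants.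
absorb-constants : ∀ c A D B τ N W m e → let E = suc (2 * c) in
  A ≤ D * B → (E * A) ^ m ≤ suc E ^ m * (τ * (D ^ m * (N * W))) → τ * N * B ^ e * E ≤ m + e →
  (c * A) ^ (m + e) ≤ W * (suc c * D) ^ (m + e)
absorb-constants c A D B τ N W m e A≤DB main large =
  *-cancelʳ-≤ _ _ ((F * F) ^ L) {{m^n≢0 (F * F) L}} (begin
    (c * A) ^ L * (F * F) ^ L                           ≡⟨ ^-distribʳ-* L (c * A) (F * F) ⟨
    (c * A * (F * F)) ^ L                               ≤⟨ ^-monoˡ-≤ L square ⟩
    (suc c * (E * (E * A))) ^ L                         ≡⟨ trans (^-distribʳ-* L (suc c) _) (cong (suc c ^ L *_) (^-distribʳ-* L E (E * A))) ⟩
    suc c ^ L * (E ^ L * (E * A) ^ L)                   ≤⟨ *-monoʳ-≤ (suc c ^ L) (*-monoʳ-≤ (E ^ L) power) ⟩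
    suc c ^ L * (E ^ L * (F ^ L * (D ^ L * (W * X))))   ≡⟨ shuffle₁ (suc c ^ L) (E ^ L) (F ^ L) (D ^ L) W X ⟩
    suc c ^ L * (F ^ L * (D ^ L * W)) * (X * E ^ L)     ≤⟨ *-monoʳ-≤ (suc c ^ L * (F ^ L * (D ^ L * W))) (bernoulli-absorb E X L large) ⟩
    suc c ^ L * (F ^ L * (D ^ L * W)) * F ^ L           ≡⟨ shuffle₂ (suc c ^ L) (F ^ L) (D ^ L) W ⟩
    W * (suc c ^ L * D ^ L) * (F ^ L * F ^ L)           ≡⟨ cong₂ (λ x y → W * x * y) (^-distribʳ-* L (suc c) D) (^-distribʳ-* L F F) ⟨
    W * (suc c * D) ^ L * (F * F) ^ L                   ∎)
  where
  open ≤-Reasoning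
  E = suc (2 * c)
  F = suc E
  L = m + e
  X = τ * N * B ^ e
  shuffle₁ : ∀ a b f d w x → a * (b * (f * (d * (w * x)))) ≡ a * (f * (d * w)) * (x * b)
  shuffle₁ = solve-∀
  shuffle₂ : ∀ a f d w → a * (f * (d * w)) * f ≡ w * (a * d) * (f * f)
  shuffle₂ = solve-∀
  -- Here F = 2(c + 1), and c F² + (c + 1) = (c + 1) E².
  square : c * A * (F * F) ≤ suc c * (E * (E * A))
  square = ≤-trans (m≤m+n _ (suc c * A)) (≤-reflexive (expand c A))
    where
    expand : ∀ c A → c * A * ((2 + 2 * c) * (2 + 2 * c)) + (1 + c) * A ≡ (1 + c) * ((1 + 2 * c) * ((1 + 2 * c) * A))
    expand = solve-∀
  -- Raises the exponent of `main` from `m` to `m + e`; the `e` extra factors are paid for with the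
  -- crude bound `A≤DB`.
  power : (E * A) ^ L ≤ F ^ L * (D ^ L * (W * X))
  power = begin
    (E * A) ^ (m + e)                                           ≡⟨ ^-distribˡ-+-* (E * A) m e ⟩
    (E * A) ^ m * (E * A) ^ e                                   ≤⟨ *-mono-≤ main (^-monoˡ-≤ e (*-mono-≤ (n≤1+n E) A≤DB)) ⟩
    F ^ m * (τ * (D ^ m * (N * W))) * (F * (D * B)) ^ e         ≡⟨ cong (F ^ m * (τ * (D ^ m * (N * W))) *_) (trans (^-distribʳ-* e F (D * B)) (cong (F ^ e *_) (^-distribʳ-* e D B))) ⟩
    F ^ m * (τ * (D ^ m * (N * W))) * (F ^ e * (D ^ e * B ^ e)) ≡⟨ regroup (F ^ m) τ (D ^ m) N W (F ^ e) (D ^ e) (B ^ e) ⟩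
    F ^ m * F ^ e * (D ^ m * D ^ e * (W * X))                   ≡⟨ cong₂ (λ x y → x * (y * (W * X))) (^-distribˡ-+-* F m e) (^-distribˡ-+-* D m e) ⟨
    F ^ L * (D ^ L * (W * X))                                   ∎
    where
    regroup : ∀ f t d n w g h b → f * (t * (d * (n * w))) * (g * (h * b)) ≡ f * g * (d * h * (w * (t * n * b)))
    regroup = solve-∀

-- c / (c + 1) plays the part of 1 - ε, and p j / D that of a rational lower bound for the root of
-- `d j * d (r ∸ j)`. `K` is fixed before the graph, `D` and `p`, so its constants may involve only
-- `r`, `c` and `d`.
theorem-ℕ : (r : ℕ) → 1 ≤ r → (c : ℕ) (d : ℕ → ℕ) →
  ∃[ K ] ((n : ℕ) (G : Graph n) → 2 ≤ n → Connected G → (∀ j → j ≤ r → δ G j ≡ d j) →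
    (k : ℕ) → K ≤ k → (D : ℕ) (p : ℕ → ℕ) →
    (∀ j → j ≤ r → p j * p j ≤ (D * D) * (d j * d (r ∸ j))) →
    (c * Σ (upTo (suc r)) p) ^ (2 * k) ≤ t G r k * (suc c * D) ^ (2 * k))
theorem-ℕ r 1≤r c d = K , go
  where
  E = suc (2 * c)
  open Tent r E
  js = upTo (suc r)
  e = levels + r + (levels + r)
  -- A bound for A / D that does not involve `D` or `p`.
  B = Σ js (λ j → d j * d (r ∸ j))
  X = top * levels * B ^ e
  -- Leaves room for the `e` closing steps and makes 2k large enough for Bernoulli to absorb `X`.
  K = e + X * E

  go : (n : ℕ) (G : Graph n) → 2 ≤ n → Connected G → (∀ j → j ≤ r → δ G j ≡ d j) →
    (k : ℕ) → K ≤ k → (D : ℕ) (p : ℕ → ℕ) →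
    (∀ j → j ≤ r → p j * p j ≤ (D * D) * (d j * d (r ∸ j))) →
    (c * Σ (upTo (suc r)) p) ^ (2 * k) ≤ t G r k * (suc c * D) ^ (2 * k)
  go n G 2≤n connected δ≡d k K≤k D p p²≤ with t-sel G r k 2≤n
  ... | x , t≡ = subst (λ W → (c * A) ^ (2 * k) ≤ W * (suc c * D) ^ (2 * k)) (≡-sym t≡)
                   (subst (λ L → (c * A) ^ L ≤ walks G r L x x * (suc c * D) ^ L) L≡ bound)
    where
    open ≤-Reasoning
    A = Σ js p
    m = 2 * k ∸ e
    K≤2k : K ≤ 2 * k
    K≤2k = ≤-trans K≤k (m≤m+n k _)
    L≡ : m + e ≡ 2 * k
    L≡ = m∸n+n≡m (≤-trans (m≤m+n e _) K≤2k)
    W = walks G r (m + e) x x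

    weight Q : ℕ → ℕ
    weight j = d (r ∸ j)
    -- `p` need not be symmetric under j ↦ r - j. The maximum is, obeys the same bound because that
    -- bound is symmetric, and only enlarges the sum.
    Q j = p j ⊔ p (r ∸ j)

    Q-sym : ∀ j → j ≤ r → Q (r ∸ j) ≡ Q j
    Q-sym j j≤r = trans (cong (p (r ∸ j) ⊔_) (cong p (m∸[m∸n]≡n j≤r))) (⊔-comm (p (r ∸ j)) (p j))

    Q²≤ : ∀ j → j ≤ r → Q j * Q j ≤ (D * weight j) * (D * weight (r ∸ j))
    Q²≤ j j≤r rewrite m∸[m∸n]≡n j≤r with ⊔-sel (p j) (p (r ∸ j))
    ... | inj₁ q rewrite q = ≤-trans (p²≤ j j≤r) (≤-reflexive (regroup D (d j) (d (r ∸ j))))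
      where
      regroup : ∀ D x y → D * D * (x * y) ≡ D * y * (D * x)
      regroup = solve-∀
    ... | inj₂ q rewrite q = ≤-trans (subst (λ i → p (r ∸ j) * p (r ∸ j) ≤ D * D * (d (r ∸ j) * d i)) (m∸[m∸n]≡n j≤r) (p²≤ (r ∸ j) (m∸n≤m r j)))
                               (≤-reflexive (*-interchange D D (d (r ∸ j)) (d j)))

    open Symmetric Q Q-sym

    main : (E * A) ^ m ≤ suc E ^ m * (top * (D ^ m * (levels * W)))
    main = begin
      (E * A) ^ m                                                                 ≤⟨ ^-monoˡ-≤ m (*-monoʳ-≤ E (Σ-mono js (λ {j} _ → m≤m⊔n (p j) _))) ⟩
      (E * ΣQ) ^ m                                                                ≤⟨ Σ-pow-lower m ⟩
      suc E ^ m * (top * Σ (upTo levels) (pow levels (toeplitz r Q) m 𝟙))         ≤⟨ *-monoʳ-≤ (suc E ^ m) (*-monoʳ-≤ top (≤-trans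
           (Σ-pow-geometric-mean levels r weight Q D Q²≤ m)
           (*-monoʳ-≤ (D ^ m) (walks-level-lower G 2≤n connected r 1≤r d δ≡d levels m x)))) ⟩
      suc E ^ m * (top * (D ^ m * (levels * W)))                                  ∎

    m≤m² : ∀ m → m ≤ m * m
    m≤m² zero    = z≤n
    m≤m² (suc m) = m≤m+n (suc m) _

    -- Uses √y ≤ y for natural y.
    p≤ : ∀ j → j ≤ r → p j ≤ D * (d j * d (r ∸ j))
    p≤ j j≤r = m²≤n²⇒m≤n (begin
      p j * p j              ≤⟨ p²≤ j j≤r ⟩
      D * D * y              ≤⟨ *-monoʳ-≤ (D * D) (m≤m² y) ⟩
      D * D * (y * y)        ≡⟨ *-interchange D D y y ⟩
      D * y * (D * y)        ∎)
      where y = d j * d (r ∸ j)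

    A≤DB : A ≤ D * B
    A≤DB = ≤-trans (Σ-mono js (λ {j} j∈ → p≤ j (≤-pred (∈-upTo⁻ j∈)))) (≤-reflexive (Σ-*ˡ js D (λ j → d j * d (r ∸ j))))

    bound : (c * A) ^ (m + e) ≤ W * (suc c * D) ^ (m + e)
    bound = absorb-constants c A D B top levels W m e A≤DB main
      (subst (X * E ≤_) (≡-sym L≡) (≤-trans (m≤n+m _ e) K≤2k))

-- Transfer to the rationals

-- An opaque copy of ℕtoℚ, whose unfolding would normalise fractions during conversion checking.
opaque
  ι : ℕ → ℚ
  ι = ℕtoℚ

  ι≡ℕtoℚ : ∀ m → ι m ≡ ℕtoℚ m
  ι≡ℕtoℚ m = refl

  ι-0 : ι 0 ≡ 0ℚ
  ι-0 = refl

  ι-1 : ι 1 ≡ 1ℚ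
  ι-1 = refl

  toℚᵘ-ι : ∀ m → ℚ.toℚᵘ (ι m) ℚᵘ.≃ ℚᵘ.mkℚᵘ (ℤ.+ m) 0
  toℚᵘ-ι m = ℚ.toℚᵘ-fromℚᵘ (ℚᵘ.mkℚᵘ (ℤ.+ m) 0)

  ι-* : ∀ m n → ι (m * n) ≡ ι m *ℚ ι n
  ι-* m n = ℚ.toℚᵘ-injective (ℚᵘ.≃-trans (toℚᵘ-ι (m * n)) (ℚᵘ.≃-sym (ℚᵘ.≃-trans (ℚ.toℚᵘ-homo-* (ι m) (ι n))
    (ℚᵘ.≃-trans (ℚᵘ.*-cong (toℚᵘ-ι m) (toℚᵘ-ι n)) (ℚᵘ.*≡* (cong (ℤ._* ℤ.+ 1) (≡-sym (ℤ.pos-* m n))))))))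

  ι-+ : ∀ m n → ι (m + n) ≡ ι m ℚ.+ ι n
  ι-+ m n = ℚ.toℚᵘ-injective (ℚᵘ.≃-trans (toℚᵘ-ι (m + n)) (ℚᵘ.≃-sym (ℚᵘ.≃-trans (ℚ.toℚᵘ-homo-+ (ι m) (ι n))
    (ℚᵘ.≃-trans (ℚᵘ.+-cong (toℚᵘ-ι m) (toℚᵘ-ι n))
      (ℚᵘ.*≡* (cong (ℤ._* ℤ.+ 1) (trans (cong₂ ℤ._+_ (ℤ.*-identityʳ (ℤ.+ m)) (ℤ.*-identityʳ (ℤ.+ n))) (≡-sym (ℤ.pos-+ m n)))))))))

  ι-mono : ∀ {m n} → m ≤ n → ι m ≤ℚ ι n
  ι-mono {m} {n} m≤n = ℚ.toℚᵘ-cancel-≤ (ℚᵘ.≤-trans (ℚᵘ.≤-reflexive (toℚᵘ-ι m)) (ℚᵘ.≤-trans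
    (ℚᵘ.*≤* (ℤ.*-monoʳ-≤-nonNeg (ℤ.+ 1) (ℤ.+≤+ m≤n))) (ℚᵘ.≤-reflexive (ℚᵘ.≃-sym (toℚᵘ-ι n)))))

  ι-cancel : ∀ {m n} → ι m ≤ℚ ι n → m ≤ n
  ι-cancel {m} {n} h with ℚᵘ.≤-trans (ℚᵘ.≤-reflexive (ℚᵘ.≃-sym (toℚᵘ-ι m))) (ℚᵘ.≤-trans (ℚ.toℚᵘ-mono-≤ h) (ℚᵘ.≤-reflexive (toℚᵘ-ι n)))
  ... | ℚᵘ.*≤* p = ℤ.drop‿+≤+ (ℤ.*-cancelʳ-≤-pos (ℤ.+ m) (ℤ.+ n) (ℤ.+ 1) p)

  clear-denominator : ∀ {q} → 0ℚ ≤ℚ q → ∃[ b ] ∃[ a ] (q *ℚ ι (suc b) ≡ ι a)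
  clear-denominator {q@(ℚ.mkℚ (ℤ.+ a) b _)} _ = b , a , ℚ.toℚᵘ-injective (ℚᵘ.≃-trans (ℚ.toℚᵘ-homo-* q (ι (suc b)))
    (ℚᵘ.≃-trans (ℚᵘ.*-cong {ℚ.toℚᵘ q} ℚᵘ.≃-refl (toℚᵘ-ι (suc b))) (ℚᵘ.≃-trans
      (ℚᵘ.*≡* (trans (ℤ.*-identityʳ _) (cong (λ k → ℤ.+ a ℤ.* ℤ.+ k) (≡-sym (*-identityʳ (suc b)))))) (ℚᵘ.≃-sym (toℚᵘ-ι a)))))
  clear-denominator {ℚ.mkℚ ℤ.-[1+ a ] b _} (ℚ.*≤* ())

ι-≥0 : ∀ m → 0ℚ ≤ℚ ι m
ι-≥0 m = subst (_≤ℚ ι m) ι-0 (ι-mono z≤n)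

ι-nonNeg : ∀ m → ℚ.NonNegative (ι m)
ι-nonNeg m = ℚ.nonNegative (ι-≥0 m)

ι-pos : ∀ {m} → 1 ≤ m → ℚ.Positive (ι m)
ι-pos {m} 1≤m = ℚ.positive (ℚ.<-≤-trans (ℚ.positive⁻¹ 1ℚ) (subst (_≤ℚ ι m) ι-1 (ι-mono 1≤m)))

-- The numerators form a function on ℕ, zero from `s` on, to fit sums over `upTo`.
common-denominator : ∀ s (q : Fin s → ℚ) → (∀ i → 0ℚ ≤ℚ q i) →
  ∃[ D ] (1 ≤ D × (∃ λ (p : ℕ → ℕ) → ∀ i → q i *ℚ ι D ≡ ι (p (toℕ i))))
common-denominator zero    q h = 1 , ≤-refl , (λ _ → 0) , λ ()
common-denominator (suc s) q h with clear-denominator (h zero) | common-denominator s (q ∘ suc) (h ∘ suc)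
... | b , a , eq | D , 1≤D , p , eqs = suc b * D , *-mono-≤ (s≤s (z≤n {b})) 1≤D , p′ , eqs′
  where
  p′ : ℕ → ℕ
  p′ zero    = a * D
  p′ (suc i) = suc b * p i
  open ≡-Reasoning
  eqs′ : ∀ i → q i *ℚ ι (suc b * D) ≡ ι (p′ (toℕ i))
  eqs′ zero = begin
    q zero *ℚ ι (suc b * D)              ≡⟨ cong (q zero *ℚ_) (ι-* (suc b) D) ⟩
    q zero *ℚ (ι (suc b) *ℚ ι D)      ≡⟨ ℚ.*-assoc (q zero) (ι (suc b)) (ι D) ⟨
    q zero *ℚ ι (suc b) *ℚ ι D        ≡⟨ cong (_*ℚ ι D) eq ⟩
    ι a *ℚ ι D                        ≡⟨ ι-* a D ⟨
    ι (a * D)                            ∎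
  eqs′ (suc i) = begin
    q (suc i) *ℚ ι (suc b * D)           ≡⟨ cong (λ k → q (suc i) *ℚ ι k) (*-comm (suc b) D) ⟩
    q (suc i) *ℚ ι (D * suc b)           ≡⟨ cong (q (suc i) *ℚ_) (ι-* D (suc b)) ⟩
    q (suc i) *ℚ (ι D *ℚ ι (suc b))   ≡⟨ ℚ.*-assoc (q (suc i)) (ι D) (ι (suc b)) ⟨
    q (suc i) *ℚ ι D *ℚ ι (suc b)     ≡⟨ cong (_*ℚ ι (suc b)) (eqs i) ⟩
    ι (p (toℕ i)) *ℚ ι (suc b)        ≡⟨ ι-* (p (toℕ i)) (suc b) ⟨
    ι (p (toℕ i) * suc b)                ≡⟨ cong ι (*-comm (p (toℕ i)) (suc b)) ⟩
    ι (suc b * p (toℕ i))                ∎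

sumFinℚ-ι : ∀ s (q : Fin s → ℚ) D (p : ℕ → ℕ) → (∀ i → q i *ℚ ι D ≡ ι (p (toℕ i))) →
  sumFinℚ q *ℚ ι D ≡ ι (Σ (upTo s) p)
sumFinℚ-ι s q D p h = trans (cong (λ xs → foldr ℚ._+_ 0ℚ xs *ℚ ι D) (map-tabulate id q))
                      (trans (go s q p h) (cong (ι ∘ sum) (≡-sym (map-upTo p s))))
  where
  go : ∀ s (q : Fin s → ℚ) (p : ℕ → ℕ) → (∀ i → q i *ℚ ι D ≡ ι (p (toℕ i))) →
       foldr ℚ._+_ 0ℚ (tabulate q) *ℚ ι D ≡ ι (sum (applyUpTo p s))
  go zero    q p h = trans (ℚ.*-zeroˡ (ι D)) (≡-sym ι-0)
  go (suc s) q p h = trans (ℚ.*-distribʳ-+ (ι D) (q zero) _)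
    (trans (cong₂ ℚ._+_ (h zero) (go s (q ∘ suc) (p ∘ suc) (h ∘ suc))) (≡-sym (ι-+ (p 0) _)))

^ℚ-nonNeg : ∀ {x} → 0ℚ ≤ℚ x → ∀ k → 0ℚ ≤ℚ x ^ℚ k
^ℚ-nonNeg 0≤x zero    = ℚ.nonNegative⁻¹ 1ℚ
^ℚ-nonNeg {x} 0≤x (suc k) = ℚ.nonNegative⁻¹ (x *ℚ x ^ℚ k)
  {{ℚ.nonNeg*nonNeg⇒nonNeg x {{ℚ.nonNegative 0≤x}} (x ^ℚ k) {{ℚ.nonNegative (^ℚ-nonNeg 0≤x k)}}}}

*ℚ-mono-≤ : ∀ {x y z w} → 0ℚ ≤ℚ y → 0ℚ ≤ℚ z → x ≤ℚ y → z ≤ℚ w → x *ℚ z ≤ℚ y *ℚ w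
*ℚ-mono-≤ {x} {y} {z} {w} 0≤y 0≤z x≤y z≤w = ℚ.≤-trans
  (ℚ.*-monoʳ-≤-nonNeg z {{ℚ.nonNegative 0≤z}} x≤y) (ℚ.*-monoˡ-≤-nonNeg y {{ℚ.nonNegative 0≤y}} z≤w)

^ℚ-clear : ∀ {x a b} → 0ℚ ≤ℚ x → x *ℚ ι b ≤ℚ ι a → ∀ k → x ^ℚ k *ℚ ι (b ^ k) ≤ℚ ι (a ^ k)
^ℚ-clear 0≤x h zero    = ℚ.≤-reflexive (ℚ.*-identityˡ (ι 1))
^ℚ-clear {x} {a} {b} 0≤x h (suc k) = subst₂ _≤ℚ_
  (trans (*ℚ-interchange x (ι b) (x ^ℚ k) (ι (b ^ k))) (cong (x *ℚ x ^ℚ k *ℚ_) (≡-sym (ι-* b (b ^ k)))))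
  (≡-sym (ι-* a (a ^ k)))
  (*ℚ-mono-≤ (ι-≥0 a)
     (ℚ.nonNegative⁻¹ _ {{ℚ.nonNeg*nonNeg⇒nonNeg (x ^ℚ k) {{ℚ.nonNegative (^ℚ-nonNeg 0≤x k)}} (ι (b ^ k)) {{ι-nonNeg (b ^ k)}}}})
     h (^ℚ-clear {x} {a} {b} 0≤x h k))

0≤sumFinℚ : ∀ s (q : Fin s → ℚ) → (∀ i → 0ℚ ≤ℚ q i) → 0ℚ ≤ℚ sumFinℚ q
0≤sumFinℚ s q h = subst (λ xs → 0ℚ ≤ℚ foldr ℚ._+_ 0ℚ xs) (≡-sym (map-tabulate id q)) (go s q h)
  where
  go : ∀ s (q : Fin s → ℚ) → (∀ i → 0ℚ ≤ℚ q i) → 0ℚ ≤ℚ foldr ℚ._+_ 0ℚ (tabulate q)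
  go zero    q h = ℚ.≤-refl
  go (suc s) q h = ℚ.+-mono-≤ (h zero) (go s (q ∘ suc) (h ∘ suc))

-- A positive fraction with denominator c + 1 is at least 1 / (c + 1).
1-ε≤ : ∀ {ε a c} → 0ℚ < ε → ε *ℚ ι (suc c) ≡ ι a → (1ℚ - ε) *ℚ ι (suc c) ≤ℚ ι c
1-ε≤ {ε} {zero} {c} 0<ε eq = contradiction
  (ℚ.<-respʳ-≡ (trans eq ι-0) (ℚ.positive⁻¹ _ {{ℚ.pos*pos⇒pos ε {{ℚ.positive 0<ε}} (ι (suc c)) {{ι-pos (s≤s z≤n)}}}})) (ℚ.<-irrefl refl)
1-ε≤ {ε} {suc a} {c} 0<ε eq = begin
  (1ℚ - ε) *ℚ C                              ≡⟨ ℚ.*-distribʳ-+ C 1ℚ (ℚ.- ε) ⟩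
  1ℚ *ℚ C ℚ.+ (ℚ.- ε) *ℚ C                   ≡⟨ cong₂ ℚ._+_ (ℚ.*-identityˡ C) (trans (≡-sym (ℚ.neg-distribˡ-* ε C)) (cong (ℚ.-_) eq)) ⟩
  C ℚ.- ι (suc a)                         ≤⟨ ℚ.+-monoʳ-≤ C (ℚ.neg-antimono-≤ (subst (_≤ℚ ι (suc a)) ι-1 (ι-mono (s≤s z≤n)))) ⟩
  C ℚ.- 1ℚ                                   ≡⟨ cong (ℚ._- 1ℚ) (trans (cong ι (+-comm 1 c)) (trans (ι-+ c 1) (cong (ι c ℚ.+_) ι-1))) ⟩
  ι c ℚ.+ 1ℚ ℚ.- 1ℚ                       ≡⟨ ℚ.+-assoc (ι c) 1ℚ (ℚ.- 1ℚ) ⟩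
  ι c ℚ.+ 0ℚ                              ≡⟨ ℚ.+-identityʳ (ι c) ⟩
  ι c                                     ∎
  where
  open ℚ.≤-Reasoning
  C = ι (suc c)

-- Both sides are multiplied by the 2k-th power of `suc c * D`, in which `suc c` clears 1 - ε and
-- `D` clears the sum.
power-bound : ∀ {r n ε} (G : Graph n) k c a D (p : ℕ → ℕ) (q : Fin (suc r) → ℚ) → 0ℚ < ε → ε ≤ℚ 1ℚ →
  ε *ℚ ι (suc c) ≡ ι a → 1 ≤ D → (∀ j → 0ℚ ≤ℚ q j) → (∀ j → q j *ℚ ι D ≡ ι (p (toℕ j))) →
  (c * Σ (upTo (suc r)) p) ^ (2 * k) ≤ t G r k * (suc c * D) ^ (2 * k) →
  ((1ℚ - ε) *ℚ sumFinℚ q) ^ℚ (2 * k) ≤ℚ ι (t G r k)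
power-bound {r} {n} {ε} G k c a D p q 0<ε ε≤1 εc≡a 1≤D 0≤q qD≡p bound =
  ℚ.*-cancelʳ-≤-pos (ι (b ^ (2 * k))) {{ι-pos (m^n>0 b {{>-nonZero 1≤b}} (2 * k))}} (begin
    x ^ℚ (2 * k) *ℚ ι (b ^ (2 * k))        ≤⟨ ^ℚ-clear {x} {c * A} {b} 0≤x xb≤cA (2 * k) ⟩
    ι ((c * A) ^ (2 * k))                  ≤⟨ ι-mono bound ⟩
    ι (t G r k * b ^ (2 * k))              ≡⟨ ι-* (t G r k) (b ^ (2 * k)) ⟩
    ι (t G r k) *ℚ ι (b ^ (2 * k))      ∎)
  where
  open ℚ.≤-Reasoning
  x = (1ℚ - ε) *ℚ sumFinℚ q
  A = Σ (upTo (suc r)) p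
  b = suc c * D
  1≤b : 1 ≤ b
  1≤b = *-mono-≤ (s≤s (z≤n {c})) 1≤D

  0≤1-ε : 0ℚ ≤ℚ 1ℚ - ε
  0≤1-ε = subst (_≤ℚ 1ℚ - ε) (ℚ.+-inverseʳ ε) (ℚ.+-monoˡ-≤ (ℚ.- ε) ε≤1)

  0≤x : 0ℚ ≤ℚ x
  0≤x = ℚ.nonNegative⁻¹ x {{ℚ.nonNeg*nonNeg⇒nonNeg (1ℚ - ε) {{ℚ.nonNegative 0≤1-ε}} (sumFinℚ q) {{ℚ.nonNegative (0≤sumFinℚ (suc r) q 0≤q)}}}}

  xb≤cA : x *ℚ ι b ≤ℚ ι (c * A)
  xb≤cA = begin
    x *ℚ ι (suc c * D)                                       ≡⟨ cong (x *ℚ_) (ι-* (suc c) D) ⟩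
    x *ℚ (ι (suc c) *ℚ ι D)                               ≡⟨ *ℚ-interchange (1ℚ - ε) (sumFinℚ q) (ι (suc c)) (ι D) ⟩
    ((1ℚ - ε) *ℚ ι (suc c)) *ℚ (sumFinℚ q *ℚ ι D)         ≡⟨ cong (((1ℚ - ε) *ℚ ι (suc c)) *ℚ_) (sumFinℚ-ι (suc r) q D p qD≡p) ⟩
    ((1ℚ - ε) *ℚ ι (suc c)) *ℚ ι A                        ≤⟨ ℚ.*-monoʳ-≤-nonNeg (ι A) {{ι-nonNeg A}} (1-ε≤ {ε} {a} {c} 0<ε εc≡a) ⟩
    ι c *ℚ ι A                                            ≡⟨ ι-* c A ⟨
    ι (c * A)                                                ∎

numerator-bound : ∀ {r n} (G : Graph n) (d : ℕ → ℕ) D (p : ℕ → ℕ) (q : Fin (suc r) → ℚ) →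
  (∀ j → j ≤ r → δ G j ≡ d j) → (∀ j → q j *ℚ ι D ≡ ι (p (toℕ j))) →
  (∀ j → q j *ℚ q j ≤ℚ ι (δ G (toℕ j) * δ G (r ∸ toℕ j))) →
  ∀ j → j ≤ r → p j * p j ≤ (D * D) * (d j * d (r ∸ j))
numerator-bound {r} G d D p q δ≡d qD≡p hq m m≤r =
  subst (λ i → p i * p i ≤ (D * D) * (d i * d (r ∸ i))) (toℕ-fromℕ< (s≤s m≤r)) (p²≤Fin (fromℕ< (s≤s m≤r)))
  where
  open ℚ.≤-Reasoning
  p²≤Fin : ∀ i → p (toℕ i) * p (toℕ i) ≤ (D * D) * (d (toℕ i) * d (r ∸ toℕ i))
  p²≤Fin i = ι-cancel (begin
    ι (p j * p j)                                ≡⟨ ι-* (p j) (p j) ⟩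
    ι (p j) *ℚ ι (p j)                        ≡⟨ cong₂ _*ℚ_ (qD≡p i) (qD≡p i) ⟨
    (q i *ℚ ι D) *ℚ (q i *ℚ ι D)              ≡⟨ *ℚ-interchange (q i) (ι D) (q i) (ι D) ⟩
    (q i *ℚ q i) *ℚ (ι D *ℚ ι D)              ≡⟨ cong ((q i *ℚ q i) *ℚ_) (ι-* D D) ⟨
    (q i *ℚ q i) *ℚ ι (D * D)                    ≤⟨ ℚ.*-monoʳ-≤-nonNeg (ι (D * D)) {{ι-nonNeg (D * D)}} (hq i) ⟩
    ι (δ G j * δ G (r ∸ j)) *ℚ ι (D * D)      ≡⟨ ι-* (δ G j * δ G (r ∸ j)) (D * D) ⟨
    ι (δ G j * δ G (r ∸ j) * (D * D))            ≡⟨ cong ι (*-comm (δ G j * δ G (r ∸ j)) (D * D)) ⟩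
    ι (D * D * (δ G j * δ G (r ∸ j)))            ≡⟨ cong₂ (λ x y → ι (D * D * (x * y))) (δ≡d j (≤-pred (toℕ<n i))) (δ≡d (r ∸ j) (m∸n≤m r j)) ⟩
    ι (D * D * (d j * d (r ∸ j)))                ∎)
    where j = toℕ i

-- Real roots are avoided: the inequality is raised to the power 2k, and the square roots are
-- replaced by arbitrary nonnegative rationals `q j` below them. The o(1) becomes a threshold `K`
-- for each ε, chosen after `r` and the values `d` of δ but before the graph.
theorem8 : (r : ℕ) → 1 ≤ r → (ε : ℚ) → 0ℚ < ε → ε ≤ℚ 1ℚ → (d : ℕ → ℕ) →
    ∃[ K ] ((n : ℕ) (G : Graph n) → 2 ≤ n → Connected G →
      (∀ j → j ≤ r → δ G j ≡ d j) →
      (k : ℕ) → 1 ≤ k → K ≤ k →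
      (q : Fin (suc r) → ℚ) →
      (∀ j → (0ℚ ≤ℚ q j) × (q j *ℚ q j ≤ℚ ℕtoℚ (δ G (toℕ j) * δ G (r ∸ toℕ j)))) →
      ((1ℚ - ε) *ℚ sumFinℚ q) ^ℚ (2 * k) ≤ℚ ℕtoℚ (t G r k))
theorem8 r 1≤r ε 0<ε ε≤1 d = from-denominator (clear-denominator (ℚ.<⇒≤ 0<ε))
  where
  Conclusion : ℕ → Set
  Conclusion K = (n : ℕ) (G : Graph n) → 2 ≤ n → Connected G →
    (∀ j → j ≤ r → δ G j ≡ d j) →
    (k : ℕ) → 1 ≤ k → K ≤ k →
    (q : Fin (suc r) → ℚ) →
    (∀ j → (0ℚ ≤ℚ q j) × (q j *ℚ q j ≤ℚ ℕtoℚ (δ G (toℕ j) * δ G (r ∸ toℕ j)))) →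
    ((1ℚ - ε) *ℚ sumFinℚ q) ^ℚ (2 * k) ≤ℚ ℕtoℚ (t G r k)

  from-denominator : (∃[ c ] ∃[ a ] (ε *ℚ ι (suc c) ≡ ι a)) → ∃[ K ] Conclusion K
  from-denominator (c , a , εc≡a) = proj₁ (theorem-ℕ r 1≤r c d) , λ n G 2≤n connected δ≡d k _ K≤k q hq →
    let D , 1≤D , p , qD≡p = common-denominator (suc r) q (λ j → proj₁ (hq j))
        q²≤ : ∀ j → q j *ℚ q j ≤ℚ ι (δ G (toℕ j) * δ G (r ∸ toℕ j))
        q²≤ j = subst (q j *ℚ q j ≤ℚ_) (≡-sym (ι≡ℕtoℚ (δ G (toℕ j) * δ G (r ∸ toℕ j)))) (proj₂ (hq j))
    in subst (((1ℚ - ε) *ℚ sumFinℚ q) ^ℚ (2 * k) ≤ℚ_) (ι≡ℕtoℚ (t G r k))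
         (power-bound G k c a D p q 0<ε ε≤1 εc≡a 1≤D (λ j → proj₁ (hq j)) qD≡p
           (proj₂ (theorem-ℕ r 1≤r c d) n G 2≤n connected δ≡d k K≤k D p (numerator-bound G d D p q δ≡d qD≡p q²≤)))
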